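{- The calculus of the probabilistic propositional logic $\mathsf{PPL}$ is (strongly) sound: for every $\Gamma\subseteq L_{\mathsf{PPL}}$ and $\varphi\in L_{\mathsf{PPL}}$, if $\Gamma\vdash\varphi$ then $\Gamma\vDash\varphi$.
   Context: **Classical part.** $B=\{B_j: j\in\mathbb N\}$ is a denumerable set of propositional symbols; $L$ is the set of propositional formulas generated from $B$ by $\neg,\supset$ (other connectives, verum $\mathsf{tt}$ and falsum $\mathsf{ff}$ are abbreviations, e.g. $\mathsf{tt}$ is $B_1\vee\neg B_1$). A valuation $v:B\to\{0,1\}$ is identified with $\{B_j: v(B_j)=1\}$; $\Vdash_c,\vDash_c$ are classical satisfaction and entailment. $B_\alpha$ is the set of symbols occurring in $\alpha$; $[\![\alpha]\!]=\{v\cap B_\alpha: v\Vdash_c\alpha\}$. For finite $A\subseteq B$ and $U\subseteq A$, $\phi_A^U$ is $\big(\bigwedge_{B_j\in U}B_j\big)\wedge\big(\bigwedge_{B_j\in A\setminus U}\neg B_j\big)$. **Stochastic valuations.** A stochastic valuation $V$ is a family $\{V_{B_j}\}_{B_j\in B}$ of random variables on a probability space $(\Omega,\mathcal F,\mu)$, $V_{B_j}$ taking values in $\{\emptyset,\{B_j\}\}$ (false/true). For finite non-empty $A\subseteq B$, $U\subseteq A$: $\mathrm{Prob}(V_A=U)=\mu\big(\bigcap_{B_j\in A}V_{B_j}^{ -1}(U\cap\{B_j\})\big)$. $\mathrm{Prob}_V(\alpha)=\sum_{U\in[\![\alpha]\!]}\mathrm{Prob}(V_{B_\alpha}=U)$.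 **RCOF.** $\mathsf{RCOF}$ is the first-order theory of real closed ordered fields over $0,1,-,+,\times,=,<$ (its theorems are exactly the sentences true in $\mathbb R$), with variables $X=\{x_k:k\in\mathbb N\}\cup\{x_\alpha:\alpha\in L\}$. $T_{\mathsf{RCOF}}$ is the set of its terms using no variable $x_\alpha$ with $\alpha\in L$; numerals $m$ and fractions $n/m$ are used as abbreviations. $t^{\mathbb R\rho}$ is the value of term $t$ in $\mathbb R$ under assignment $\rho:X\to\mathbb R$. **Language.** $L_{\mathsf{PPL}}$ is generated by: $\int\alpha\mathbin{@}p\in L_{\mathsf{PPL}}$ for $\alpha\in L$, $p\in T_{\mathsf{RCOF}}$, $@\in\{=,<\}$; and $\varphi_1\supset\varphi_2\in L_{\mathsf{PPL}}$ for $\varphi_1,\varphi_2\in L_{\mathsf{PPL}}$. Abbreviations: $\neg\varphi$ is $\varphi\supset(\int\mathsf{tt}<1)$; $\wedge,\vee,\equiv$ are defined from $\neg,\supset$ as usual; $\int\alpha\le p$ is $(\int\alpha=p)\vee(\int\alpha<p)$; $\int\alpha\ge p$ is $\neg(\int\alpha<p)$. **Semantics.** $V\rho\Vdash\int\alpha\mathbin{@}p$ iff $\mathrm{Prob}_V(\alpha)\mathbin{@}p^{\mathbb R\rho}$; $V\rho\Vdash\varphi_1\supset\varphi_2$ iff $V\rho\not\Vdash\varphi_1$ or $V\rho\Vdash\varphi_2$. $\Gamma\vDash\varphi$ iff for all $V$ and $\rho:X\to\mathbb R$, if $V\rho\Vdash\gamma$ for all $\gamma\in\Gamma$ then $V\rho\Vdash\varphi$.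 **Adequate sets.** $\Lambda=\{\alpha_{11},\dots,\alpha_{1m_1},\dots,\alpha_{k1},\dots,\alpha_{km_k}\}\subset L$ is an adequate set of DNF-conjuncts for $\{\alpha_1,\dots,\alpha_k\}\subset L$ if: (1) the set of symbols of every $\alpha_{j\ell}$ is $B_\Lambda:=B_{\alpha_1}\cup\dots\cup B_{\alpha_k}$; (2) each $\alpha_{j\ell}$ is a conjunction of literals; (3) $\vDash_c\neg(\alpha_{j\ell}\wedge\alpha_{j\ell'})$ for $1\le\ell\ne\ell'\le m_j$; (4) $\vDash_c\alpha_j\equiv\bigvee_{\ell=1}^{m_j}\alpha_{j\ell}$ for each $j$. Then $Q^{\alpha_1,\dots,\alpha_k}_{\alpha_{11},\dots,\alpha_{km_k}}$ is the $\mathsf{RCOF}$ formula $$\Big(\bigwedge_{U\subseteq B_\Lambda}0\le x_{\phi^U_{B_\Lambda}}\le1\Big)\wedge\Big(\sum_{U\subseteq B_\Lambda}x_{\phi^U_{B_\Lambda}}=1\Big)\wedge\bigwedge_{j=1}^k\Big(x_{\alpha_j}=\sum_{\ell=1}^{m_j}x_{\alpha_{j\ell}}\Big).$$ **Calculus.** Axioms: (TT) every tautological formula of $L_{\mathsf{PPL}}$, i.e. every formula obtained from a classical tautology over $\neg,\supset$ by uniformly replacing propositional symbols by $\mathsf{PPL}$ formulas, with $\neg\varphi$ read as the $\mathsf{PPL}$ formula $\varphi\supset(\int\mathsf{tt}<1)$. (RR) every formula $\big(\int\alpha_1@_1p_1\wedge\dots\wedge\int\alpha_k@_kp_k\big)\supset\int\alpha_{k+1}@_{k+1}p_{k+1}$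 ($k\ge0$; just the conclusion if $k=0$), where $\alpha_j\in L$, $p_j\in T_{\mathsf{RCOF}}$, $@_j\in\{=,<,\le,\ge\}$, such that for some adequate set $\{\alpha_{11},\dots,\alpha_{(k+1)m_{k+1}}\}$ of DNF-conjuncts for $\{\alpha_1,\dots,\alpha_{k+1}\}$ the universal closure of $\big(Q^{\alpha_1,\dots,\alpha_{k+1}}_{\alpha_{11},\dots,\alpha_{(k+1)m_{k+1}}}\wedge\bigwedge_{j=1}^k(x_{\alpha_j}@_jp_j)\big)\supset(x_{\alpha_{k+1}}@_{k+1}p_{k+1})$ is a theorem of $\mathsf{RCOF}$. Rule: (MP) from $\varphi_1$ and $\varphi_1\supset\varphi_2$ infer $\varphi_2$. $\Gamma\vdash\varphi$ means there is a finite derivation of $\varphi$ from members of $\Gamma$ and axioms using MP. -}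

module Defs where

open import Level using (Level; Lift; 0ℓ; _⊔_) renaming (suc to lsuc)
open import Algebra.Bundles using (CommutativeRing)
open import Data.Bool using (Bool; true; false; not; _∨_)
import Data.Bool.Properties as Bool
open import Data.Empty using (⊥)
open import Data.Empty.Polymorphic using () renaming (⊥ to ⊥ℓ)
open import Data.List using (List; []; _∷_; _++_; _∷ʳ_; map; filter; filterᵇ; foldr; concatMap; zipWith; upTo)
open import Data.List.Extrema.Nat using (max; xs≤max)
open import Data.List.Membership.DecPropositional using () renaming (_∈?_ to dec-∈)
open import Data.List.Membership.Propositional using (_∈_)
open import Data.List.Membership.Propositional.Properties using (∈-filter⁺; ∈-upTo⁺; ∈-++⁺ˡ; ∈-++⁺ʳ)
open import Data.List.NonEmpty using (foldr₁) renaming (_∷_ to _∷⁺_)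
open import Data.List.Properties using (≡-dec)
open import Data.List.Relation.Binary.Pointwise using (Pointwise)
open import Data.List.Relation.Unary.All using (All) renaming (lookup to All-lookup)
open import Data.List.Relation.Unary.AllPairs using (AllPairs)
open import Data.List.Relation.Unary.Any using (here; there)
open import Data.Nat using (ℕ; zero; suc; s≤s)
import Data.Nat as ℕ
open import Data.Product using (_×_; _,_; ∃)
open import Data.Sum using (_⊎_)
open import Data.Unit.Polymorphic using () renaming (⊤ to ⊤ℓ)
open import Data.Vec using (Vec) renaming (_∷ʳ_ to _∷ʳᵛ_; foldr′ to foldrᵛ)
open import Function using (_∘_)
open import Relation.Binary.Core using (Rel)
open import Relation.Binary.Definitions using (DecidableEquality)
open import Relation.Binary.PropositionalEquality using (_≡_; _≢_; refl; sym; trans; cong; cong₂)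
open import Relation.Binary.Structures using (IsStrictTotalOrder)
open import Relation.Nullary using (¬_; Dec; yes; no; does; ¬?)
open import Relation.Nullary.Decidable using (map′; _×-dec_)
open import Relation.Unary using (Pred; ∁; ⋃; _≐_) renaming (_⊥_ to _disjoint_)

infix  30 ~_
infixr 25 _∧ᶜ_
infixr 24 _∨ᶜ_
infixr 23 _⊃_
infix  22 _≡ᶜ_

data L : Set where
  B   : ℕ → L
  ~_  : L → L
  _⊃_ : L → L → L

_∨ᶜ_ _∧ᶜ_ _≡ᶜ_ : L → L → L
α ∨ᶜ β = ~ α ⊃ β
α ∧ᶜ β = ~ (α ⊃ ~ β)
α ≡ᶜ β = (α ⊃ β) ∧ᶜ (β ⊃ α)

tt ff : L
tt = B 1 ∨ᶜ ~ B 1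
ff = ~ tt

infix 4 _≟ᴸ_

_≟ᴸ_ : DecidableEquality L
B i     ≟ᴸ B j     = map′ (cong B) (λ { refl → refl }) (i ℕ.≟ j)
B _     ≟ᴸ ~ _     = no λ ()
B _     ≟ᴸ _ ⊃ _   = no λ ()
~ _     ≟ᴸ B _     = no λ ()
~ α     ≟ᴸ ~ β     = map′ (cong ~_) (λ { refl → refl }) (α ≟ᴸ β)
~ _     ≟ᴸ _ ⊃ _   = no λ ()
_ ⊃ _   ≟ᴸ B _     = no λ ()
_ ⊃ _   ≟ᴸ ~ _     = no λ ()
α ⊃ α′  ≟ᴸ β ⊃ β′  =
  map′ (λ { (p , q) → cong₂ _⊃_ p q }) (λ { refl → refl , refl }) ((α ≟ᴸ β) ×-dec (α′ ≟ᴸ β′))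

Valuation : Set
Valuation = ℕ → Bool

value : Valuation → L → Bool
value v (B j)   = v j
value v (~ α)   = not (value v α)
value v (α ⊃ β) = not (value v α) ∨ value v β

infix 4 _⊩ᶜ_ ⊨ᶜ_

_⊩ᶜ_ : Valuation → L → Set
v ⊩ᶜ α = value v α ≡ true

⊨ᶜ_ : L → Set
⊨ᶜ α = ∀ v → v ⊩ᶜ α

-- Finite sets of propositional symbols.  They are represented by lists of
-- indices; the sets B[ α ] and their subsets are always listed in
-- increasing order without repetitions, so that equal sets are equal lists.

infix 4 _∈?_

_∈?_ : (j : ℕ) (A : List ℕ) → Dec (j ∈ A)
_∈?_ = dec-∈ ℕ._≟_

occurrences : L → List ℕ
occurrences (B j)   = j ∷ []
occurrences (~ α)   = occurrences α
occurrences (α ⊃ β) = occurrences α ++ occurrences β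

toSet : List ℕ → List ℕ
toSet js = filter (_∈? js) (upTo (suc (max 0 js)))

B[_] : L → List ℕ
B[ α ] = toSet (occurrences α)

B⋃ : List L → List ℕ
B⋃ αs = toSet (concatMap occurrences αs)

subsets : List ℕ → List (List ℕ)
subsets []      = [] ∷ []
subsets (j ∷ A) = map (j ∷_) (subsets A) ++ subsets A

infixl 7 _∩_

_∩_ : Valuation → List ℕ → List ℕ
v ∩ A = filterᵇ v A

⟦_⟧ : L → Pred (List ℕ) 0ℓ
⟦ α ⟧ U = ∃ λ v → v ⊩ᶜ α × v ∩ B[ α ] ≡ U

-- The identification of a set of symbols with a valuation.
⟨_⟩ : List ℕ → Valuation
⟨ U ⟩ j = does (j ∈? U)

-- ⟦ α ⟧ is decidable, because U ∈ ⟦ α ⟧ is witnessed by ⟨ U ⟩ if at all.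

value-cong : ∀ {v w} α → (∀ {j} → j ∈ occurrences α → v j ≡ w j) → value v α ≡ value w α
value-cong (B j)   h = h (here refl)
value-cong (~ α)   h = cong not (value-cong α h)
value-cong (α ⊃ β) h =
  cong₂ (λ a b → not a ∨ b)
    (value-cong α (h ∘ ∈-++⁺ˡ)) (value-cong β (h ∘ ∈-++⁺ʳ (occurrences α)))

∈-toSet : ∀ {j} js → j ∈ js → j ∈ toSet js
∈-toSet js j∈ = ∈-filter⁺ (_∈? js) (∈-upTo⁺ (s≤s (All-lookup (xs≤max 0 js) j∈))) j∈

∩-cong : ∀ {v w} A → (∀ {j} → j ∈ A → v j ≡ w j) → v ∩ A ≡ w ∩ A
∩-cong [] h = refl
∩-cong {v} {w} (j ∷ A) h with v j | w j | h (here refl)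
... | true  | true  | _ = cong (j ∷_) (∩-cong A (h ∘ there))
... | false | false | _ = ∩-cong A (h ∘ there)

∈-∩⁺ : ∀ {v j} A → j ∈ A → v j ≡ true → j ∈ v ∩ A
∈-∩⁺ {v} (i ∷ A) (here refl) e with v i
∈-∩⁺ (i ∷ A) (here refl) refl | true = here refl
∈-∩⁺ {v} (i ∷ A) (there p) e with v i
... | true  = there (∈-∩⁺ A p e)
... | false = ∈-∩⁺ A p e

∈-∩⁻ : ∀ {v j} A → j ∈ v ∩ A → v j ≡ true
∈-∩⁻ {v} (i ∷ A) p with v i in eq
∈-∩⁻ (i ∷ A) (here refl) | true  = eq
∈-∩⁻ (i ∷ A) (there p)   | true  = ∈-∩⁻ A p
∈-∩⁻ (i ∷ A) p           | false = ∈-∩⁻ A p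

⟨∩⟩-agrees : ∀ {v j} A → j ∈ A → ⟨ v ∩ A ⟩ j ≡ v j
⟨∩⟩-agrees {v} {j} A j∈A with j ∈? v ∩ A
... | yes p = sym (∈-∩⁻ A p)
... | no ¬p = sym (Bool.¬-not (λ e → ¬p (∈-∩⁺ A j∈A e)))

_∈⟦_⟧? : ∀ U α → Dec (⟦ α ⟧ U)
U ∈⟦ α ⟧? =
  map′ (⟨ U ⟩ ,_) canonical
    ((value ⟨ U ⟩ α Bool.≟ true) ×-dec ≡-dec ℕ._≟_ (⟨ U ⟩ ∩ B[ α ]) U)
  where
  canonical : ⟦ α ⟧ U → ⟨ U ⟩ ⊩ᶜ α × ⟨ U ⟩ ∩ B[ α ] ≡ U
  canonical (v , v⊩α , refl) =
    trans (value-cong α (⟨∩⟩-agrees B[ α ] ∘ ∈-toSet (occurrences α))) v⊩α ,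
    ∩-cong B[ α ] (⟨∩⟩-agrees B[ α ])

-- φ[ A , U ] is the conjunction of the positive literals for U followed by
-- that of the negative literals for A ∖ U.  An empty one of these two
-- conjunctions is omitted, so that φ[ A , U ] is a conjunction of literals
-- with B[ φ[ A , U ] ] = A.  (The case A = ∅ never occurs for A = B[ α ].)

literals : List L → L
literals []       = tt
literals (α ∷ αs) = foldr₁ _∧ᶜ_ (α ∷⁺ αs)

φ[_,_] : List ℕ → List ℕ → L
φ[ A , U ] with map B U | map (~_ ∘ B) (filter (λ j → ¬? (j ∈? U)) A)
... | []      | neg     = literals neg
... | p ∷ pos | []      = literals (p ∷ pos)
... | p ∷ pos | n ∷ neg = literals (p ∷ pos) ∧ᶜ literals (n ∷ neg)

data Literal : L → Set where
  positive : ∀ j → Literal (B j)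
  negative : ∀ j → Literal (~ B j)

data LiteralConjunction : L → Set where
  literal : ∀ {α} → Literal α → LiteralConjunction α
  _∧_     : ∀ {α β} → LiteralConjunction α → LiteralConjunction β → LiteralConjunction (α ∧ᶜ β)

⋁ᶜ : List L → L
⋁ᶜ = foldr _∨ᶜ_ ff

-- βs = α_{j1}, …, α_{jm_j} satisfies the conditions for α = α_j, where A = B_Λ.
-- AllPairs ranges over ℓ < ℓ′; the condition is symmetric in ℓ and ℓ′.
record DNFConjuncts (A : List ℕ) (α : L) (βs : List L) : Set where
  field
    symbols   : All (λ β → B[ β ] ≡ A) βs
    conjuncts : All LiteralConjunction βs
    exclusive : AllPairs (λ β β′ → ⊨ᶜ ~ (β ∧ᶜ β′)) βs
    dnf       : ⊨ᶜ α ≡ᶜ ⋁ᶜ βs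

Adequate : List L → List (List L) → Set
Adequate αs Λ = Pointwise (DNFConjuncts (B⋃ αs)) αs Λ

record OrderedField : Set₁ where
  field
    commutativeRing : CommutativeRing 0ℓ 0ℓ
  open CommutativeRing commutativeRing public
  infix 4 _<_ _≤_
  field
    _<_                : Rel Carrier 0ℓ
    isStrictTotalOrder : IsStrictTotalOrder _≈_ _<_
    1≉0                : ¬ (1# ≈ 0#)
    inverse            : ∀ x → ¬ (x ≈ 0#) → ∃ λ y → x * y ≈ 1#
    +-monoˡ-<          : ∀ z {x y} → x < y → x + z < y + z
    *-pos              : ∀ {x y} → 0# < x → 0# < y → 0# < x * y

  _≤_ : Rel Carrier 0ℓ
  x ≤ y = x < y ⊎ x ≈ y

  ∑ : List Carrier → Carrier
  ∑ = foldr _+_ 0#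

  -- a₀ ∷ … ∷ aₙ ∷ [] denotes the polynomial a₀ + a₁ x + … + aₙ xⁿ.
  polynomial : ∀ {n} → Vec Carrier n → Carrier → Carrier
  polynomial as x = foldrᵛ (λ a r → a + x * r) 0# as

record RealClosedField : Set₁ where
  field
    orderedField : OrderedField
  open OrderedField orderedField public
  field
    sqrt    : ∀ x → 0# < x → ∃ λ y → y * y ≈ x
    oddRoot : ∀ n (as : Vec Carrier (suc (2 ℕ.* n))) a → ¬ (a ≈ 0#) →
              ∃ λ x → polynomial (as ∷ʳᵛ a) x ≈ 0#

-- The real numbers, as an arbitrary Dedekind complete ordered field; up to
-- isomorphism there is exactly one.
record Reals : Set₁ where
  field
    orderedField : OrderedField
  open OrderedField orderedField public

  IsUpperBound : Pred Carrier 0ℓ → Pred Carrier 0ℓ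
  IsUpperBound S b = ∀ x → S x → x ≤ b

  field
    supremum : ∀ (S : Pred Carrier 0ℓ) → ∃ S → ∃ (IsUpperBound S) →
               ∃ λ s → IsUpperBound S s × (∀ b → IsUpperBound S b → s ≤ b)

  Converges : (ℕ → Carrier) → Carrier → Set
  Converges s l =
    ∀ ε → 0# < ε → ∃ λ N → ∀ n → N ℕ.≤ n → s n - l < ε × l - s n < ε

  partialSum : (ℕ → Carrier) → ℕ → Carrier
  partialSum a zero    = 0#
  partialSum a (suc n) = partialSum a n + a n

infix  8 ⊖_
infixl 7 _⊗_
infixl 6 _⊕_

data Term (V : Set) : Set where
  var     : V → Term V
  𝟘 𝟙     : Term V
  ⊖_      : Term V → Term V
  _⊕_ _⊗_ : Term V → Term V → Term V

data X : Set where
  xᴺ : ℕ → X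
  xᴸ : L → X

infix 4 _≟ˣ_

_≟ˣ_ : DecidableEquality X
xᴺ k ≟ˣ xᴺ l = map′ (cong xᴺ) (λ { refl → refl }) (k ℕ.≟ l)
xᴺ _ ≟ˣ xᴸ _ = no λ ()
xᴸ _ ≟ˣ xᴺ _ = no λ ()
xᴸ α ≟ˣ xᴸ β = map′ (cong xᴸ) (λ { refl → refl }) (α ≟ᴸ β)

-- The terms using no variable xᴸ α; ⌜_⌝ is the inclusion.
T-RCOF : Set
T-RCOF = Term ℕ

⌜_⌝ : T-RCOF → Term X
⌜ var k ⌝ = var (xᴺ k)
⌜ 𝟘 ⌝     = 𝟘
⌜ 𝟙 ⌝     = 𝟙
⌜ ⊖ t ⌝   = ⊖ ⌜ t ⌝
⌜ t ⊕ u ⌝ = ⌜ t ⌝ ⊕ ⌜ u ⌝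
⌜ t ⊗ u ⌝ = ⌜ t ⌝ ⊗ ⌜ u ⌝

∑ᵗ : List (Term X) → Term X
∑ᵗ = foldr _⊕_ 𝟘

infix  10 _≐ᶠ_ _≺ᶠ_ _≼ᶠ_
infixr 9  _∧ᶠ_
infixr 8  _∨ᶠ_
infixr 7  _⇒ᶠ_

data Fm : Set where
  _≐ᶠ_ _≺ᶠ_ : Term X → Term X → Fm
  ⊥ᶠ        : Fm
  _⇒ᶠ_      : Fm → Fm → Fm
  ∀ᶠ        : X → Fm → Fm

¬ᶠ : Fm → Fm
¬ᶠ φ = φ ⇒ᶠ ⊥ᶠ

_∨ᶠ_ _∧ᶠ_ : Fm → Fm → Fm
φ ∨ᶠ ψ = ¬ᶠ φ ⇒ᶠ ψ
φ ∧ᶠ ψ = ¬ᶠ (φ ⇒ᶠ ¬ᶠ ψ)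

_≼ᶠ_ : Term X → Term X → Fm
t ≼ᶠ u = t ≐ᶠ u ∨ᶠ t ≺ᶠ u

⋀ᶠ : List Fm → Fm
⋀ᶠ = foldr _∧ᶠ_ (¬ᶠ ⊥ᶠ)

varsᵗ : Term X → List X
varsᵗ (var x) = x ∷ []
varsᵗ 𝟘       = []
varsᵗ 𝟙       = []
varsᵗ (⊖ t)   = varsᵗ t
varsᵗ (t ⊕ u) = varsᵗ t ++ varsᵗ u
varsᵗ (t ⊗ u) = varsᵗ t ++ varsᵗ u

freeVars : Fm → List X
freeVars (t ≐ᶠ u) = varsᵗ t ++ varsᵗ u
freeVars (t ≺ᶠ u) = varsᵗ t ++ varsᵗ u
freeVars ⊥ᶠ       = []
freeVars (φ ⇒ᶠ ψ) = freeVars φ ++ freeVars ψ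
freeVars (∀ᶠ x φ) = filter (λ y → ¬? (y ≟ˣ x)) (freeVars φ)

universalClosure : Fm → Fm
universalClosure φ = foldr ∀ᶠ φ (freeVars φ)

module _ (K : OrderedField) where
  open OrderedField K

  Assignment : Set
  Assignment = X → Carrier

  _[_↦_] : Assignment → X → Carrier → Assignment
  (ρ [ x ↦ a ]) y with y ≟ˣ x
  ... | yes _ = a
  ... | no  _ = ρ y

  evalᵗ : Assignment → Term X → Carrier
  evalᵗ ρ (var x) = ρ x
  evalᵗ ρ 𝟘       = 0#
  evalᵗ ρ 𝟙       = 1#
  evalᵗ ρ (⊖ t)   = - evalᵗ ρ t
  evalᵗ ρ (t ⊕ u) = evalᵗ ρ t + evalᵗ ρ u
  evalᵗ ρ (t ⊗ u) = evalᵗ ρ t * evalᵗ ρ u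

  Holds : Assignment → Fm → Set
  Holds ρ (t ≐ᶠ u) = evalᵗ ρ t ≈ evalᵗ ρ u
  Holds ρ (t ≺ᶠ u) = evalᵗ ρ t < evalᵗ ρ u
  Holds ρ ⊥ᶠ       = ⊥
  Holds ρ (φ ⇒ᶠ ψ) = Holds ρ φ → Holds ρ ψ
  Holds ρ (∀ᶠ x φ) = ∀ a → Holds (ρ [ x ↦ a ]) φ

-- A sentence belongs to the first-order theory of real closed ordered fields
-- if it holds in all of them.  Quantifying over fields in the lowest universe
-- is no restriction, by the Löwenheim–Skolem theorem.
RCOF-Theorem : Fm → Set₁
RCOF-Theorem φ = ∀ K ρ → Holds (RealClosedField.orderedField K) ρ φ

data Cmp : Set where
  eq lt : Cmp

infix  30 ∫_[_]_ ¬ᵖ_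
infixr 25 _∧ᵖ_
infixr 24 _∨ᵖ_
infixr 23 _⊃ᵖ_

data PPL : Set where
  ∫_[_]_ : L → Cmp → T-RCOF → PPL
  _⊃ᵖ_   : PPL → PPL → PPL

¬ᵖ_ : PPL → PPL
¬ᵖ φ = φ ⊃ᵖ ∫ tt [ lt ] 𝟙

_∨ᵖ_ _∧ᵖ_ : PPL → PPL → PPL
φ ∨ᵖ ψ = ¬ᵖ φ ⊃ᵖ ψ
φ ∧ᵖ ψ = ¬ᵖ (φ ⊃ᵖ ¬ᵖ ψ)

data Cmp⁺ : Set where
  eq lt le ge : Cmp⁺

record Constraint : Set where
  constructor _[_]_
  field
    formula    : L
    comparison : Cmp⁺
    bound      : T-RCOF
open Constraint public

∫ᶜ : Constraint → PPL
∫ᶜ (α [ eq ] p) = ∫ α [ eq ] p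
∫ᶜ (α [ lt ] p) = ∫ α [ lt ] p
∫ᶜ (α [ le ] p) = ∫ α [ eq ] p ∨ᵖ ∫ α [ lt ] p
∫ᶜ (α [ ge ] p) = ¬ᵖ ∫ α [ lt ] p

xᶜ : Constraint → Fm
xᶜ (α [ eq ] p) = var (xᴸ α) ≐ᶠ ⌜ p ⌝
xᶜ (α [ lt ] p) = var (xᴸ α) ≺ᶠ ⌜ p ⌝
xᶜ (α [ le ] p) = var (xᴸ α) ≼ᶠ ⌜ p ⌝
xᶜ (α [ ge ] p) = ⌜ p ⌝ ≼ᶠ var (xᴸ α)

instantiate : (ℕ → PPL) → L → PPL
instantiate σ (B j)   = σ j
instantiate σ (~ α)   = ¬ᵖ instantiate σ α
instantiate σ (α ⊃ β) = instantiate σ α ⊃ᵖ instantiate σ β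

-- (⋀_U 0 ≤ x_{φ^U} ≤ 1) ∧ (∑_U x_{φ^U} = 1) ∧ ⋀_j (x_{α_j} = ∑_ℓ x_{α_{jℓ}}),
-- where U ranges over the subsets of B_Λ.
Q : List L → List (List L) → Fm
Q αs Λ =
  ⋀ᶠ (map (λ x → 𝟘 ≼ᶠ x ∧ᶠ x ≼ᶠ 𝟙) xφs)
  ∧ᶠ ∑ᵗ xφs ≐ᶠ 𝟙
  ∧ᶠ ⋀ᶠ (zipWith (λ α βs → var (xᴸ α) ≐ᶠ ∑ᵗ (map (var ∘ xᴸ) βs)) αs Λ)
  where
  xφs : List (Term X)
  xφs = map (λ U → var (xᴸ φ[ B⋃ αs , U ])) (subsets (B⋃ αs))

-- c₁ ∧ … ∧ cₖ ⊃ c, or just c if k = 0.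
_⟶_ : List Constraint → Constraint → PPL
[]       ⟶ c = ∫ᶜ c
(d ∷ ds) ⟶ c = foldr₁ _∧ᵖ_ (∫ᶜ d ∷⁺ map ∫ᶜ ds) ⊃ᵖ ∫ᶜ c

data Axiom : PPL → Set₁ where
  TT : ∀ τ (σ : ℕ → PPL) → ⊨ᶜ τ → Axiom (instantiate σ τ)
  RR : ∀ cs c Λ → Adequate (map formula (cs ∷ʳ c)) Λ →
       RCOF-Theorem (universalClosure (Q (map formula (cs ∷ʳ c)) Λ ∧ᶠ ⋀ᶠ (map xᶜ cs) ⇒ᶠ xᶜ c)) →
       Axiom (cs ⟶ c)

infix 3 _⊢_

data _⊢_ {g} (Γ : Pred PPL g) : PPL → Set (lsuc 0ℓ ⊔ g) where
  hyp   : ∀ {φ} → Γ φ → Γ ⊢ φ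
  axiom : ∀ {φ} → Axiom φ → Γ ⊢ φ
  MP    : ∀ {φ ψ} → Γ ⊢ φ → Γ ⊢ φ ⊃ᵖ ψ → Γ ⊢ ψ

record ProbabilitySpace (ℝ : Reals) (ℓ f : Level) : Set (lsuc (ℓ ⊔ f)) where
  open Reals ℝ
  field
    Ω : Set ℓ
    𝓕 : Pred (Pred Ω ℓ) f
    -- Only the values of μ on 𝓕 are meaningful.
    μ : Pred Ω ℓ → Carrier

    𝓕-resp-≐     : ∀ {E F} → E ≐ F → 𝓕 E → 𝓕 F
    𝓕-whole      : 𝓕 (λ _ → ⊤ℓ)
    𝓕-complement : ∀ {E} → 𝓕 E → 𝓕 (∁ E)
    𝓕-union      : ∀ (E : ℕ → Pred Ω ℓ) → (∀ n → 𝓕 (E n)) → 𝓕 (⋃ ℕ E)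

    μ-cong        : ∀ {E F} → 𝓕 E → 𝓕 F → E ≐ F → μ E ≈ μ F
    μ-nonNegative : ∀ {E} → 𝓕 E → 0# ≤ μ E
    μ-empty       : μ (λ _ → ⊥ℓ) ≈ 0#
    μ-whole       : μ (λ _ → ⊤ℓ) ≈ 1#
    μ-σ-additive  : ∀ (E : ℕ → Pred Ω ℓ) → (∀ n → 𝓕 (E n)) →
                    (∀ m n → m ≢ n → E m disjoint E n) →
                    Converges (partialSum (μ ∘ E)) (μ (⋃ ℕ E))

-- V j ω ≡ true encodes V_{B_j}(ω) = {B_j}, and V j ω ≡ false encodes
-- V_{B_j}(ω) = ∅.
record StochasticValuation (ℝ : Reals) (ℓ f : Level) : Set (lsuc (ℓ ⊔ f)) where
  field
    space : ProbabilitySpace ℝ ℓ f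
  open Reals ℝ
  open ProbabilitySpace space public
  field
    V : ℕ → Ω → Bool

  preimage : ℕ → Bool → Pred Ω ℓ
  preimage j b ω = Lift ℓ (V j ω ≡ b)

  field
    measurable : ∀ j b → 𝓕 (preimage j b)

  -- Prob(V_A = U)
  Prob[_≔_] : List ℕ → List ℕ → Carrier
  Prob[ A ≔ U ] = μ (λ ω → All (λ j → preimage j (⟨ U ⟩ j) ω) A)

  Prob : L → Carrier
  Prob α = ∑ (map Prob[ B[ α ] ≔_] (filter _∈⟦ α ⟧? (subsets B[ α ])))

module _ (ℝ : Reals) where
  open Reals ℝ

  compare : Cmp → Rel Carrier 0ℓ
  compare eq = _≈_
  compare lt = _<_

  module _ {ℓ f} (𝓥 : StochasticValuation ℝ ℓ f) (ρ : Assignment orderedField) where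
    open StochasticValuation 𝓥 using (Prob)

    Satisfies : PPL → Set
    Satisfies (∫ α [ c ] p) = compare c (Prob α) (evalᵗ orderedField ρ ⌜ p ⌝)
    Satisfies (φ ⊃ᵖ ψ)      = ¬ Satisfies φ ⊎ Satisfies ψ

infix 3 Entails
syntax Entails ℝ ℓ f Γ φ = Γ ⊨[ ℝ , ℓ , f ] φ

Entails : ∀ (ℝ : Reals) (ℓ f : Level) {g} → Pred PPL g → PPL → Set (lsuc (ℓ ⊔ f) ⊔ g)
Entails ℝ ℓ f Γ φ =
  ∀ (𝓥 : StochasticValuation ℝ ℓ f) (ρ : Assignment (Reals.orderedField ℝ)) →
  (∀ γ → Γ γ → Satisfies ℝ 𝓥 ρ γ) → Satisfies ℝ 𝓥 ρ φ

{-# OPTIONS --safe #-}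

-- Every Dedekind complete ordered field is real closed: a continuous function
-- vanishes at the supremum of the set where it is negative, and polynomials
-- are locally Lipschitz with a sign at ±∞ given by the leading coefficient.
-- So a theorem of RCOF may be instantiated in ℝ, at the assignment
-- x_α ↦ Prob α.  There the formula Q holds, because Prob α is the measure of
-- the event {ω : V(ω) ⊩ α}; this reduces the equations of Q to finite
-- additivity and to classical facts about DNFs.  Trichotomy makes
-- satisfaction decidable, which is what the tautologies need.

module Submission where

open import Defs
open import Level using (Level; 0ℓ; Lift; lift; lower)
open import Relation.Unary using (Pred; ⋃; _≐_)
import Algebra.Properties.AbelianGroup as AbelianGroupProperties
import Algebra.Properties.Ring as RingProperties
import Algebra.Properties.Semiring.Exp as Exponentiation
import Algebra.Solver.Ring.NaturalCoefficients.Default as SemiringSolver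
import Data.Bool.Properties as Bool
open import Data.Bool using (true; false; not)
open import Data.Empty using (⊥-elim)
open import Data.Empty.Polymorphic using () renaming (⊥ to ⊥ℓ)
open import Data.List using (List; []; _∷_; _∷ʳ_; concatMap; map; filter; foldr; zipWith)
open import Data.List.Membership.Propositional using (_∈_; find; lose)
open import Data.List.Membership.Propositional.Properties
  using (∈-map⁺; ∈-map⁻; ∈-++⁺ˡ; ∈-++⁺ʳ; ∈-++⁻; ∈-filter⁺; ∈-filter⁻)
open import Data.List.NonEmpty using (foldr₁) renaming (_∷_ to _∷⁺_)
open import Data.List.Properties using (∷-injectiveʳ; map-∘)
open import Data.List.Relation.Binary.Pointwise using (Pointwise; []; _∷_)
open import Data.List.Relation.Unary.All as All using (All; []; _∷_)
import Data.List.Relation.Unary.All.Properties as All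
open import Data.List.Relation.Unary.AllPairs as AllPairs using (AllPairs; []; _∷_)
import Data.List.Relation.Unary.AllPairs.Properties as AllPairs
open import Data.List.Relation.Unary.Any using (Any; here; there)
import Data.List.Relation.Unary.Any.Properties as Any
open import Data.List.Relation.Unary.Unique.Propositional using (Unique)
import Data.List.Relation.Unary.Unique.Propositional.Properties as Unique
open import Data.Nat using (ℕ; zero; suc)
import Data.Nat as ℕ
open import Data.Nat.Properties using (m≤n+m)
open import Data.Product using (_×_; _,_; ∃; proj₁; proj₂)
open import Data.Sum using (_⊎_; inj₁; inj₂)
open import Data.Vec using (Vec; []; _∷_) renaming (_∷ʳ_ to _∷ʳᵛ_)
open import Function using (_∘_; mk⇔)
open import Relation.Binary.Bundles using (StrictPartialOrder)
open import Relation.Binary.Definitions using (tri<; tri≈; tri>)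
open import Relation.Binary.PropositionalEquality as ≡ using (_≡_; _≢_; cong; cong₂; subst; subst₂)
import Relation.Binary.Reasoning.StrictPartialOrder as StrictReasoning
open import Relation.Binary.Structures using (IsStrictTotalOrder)
open import Relation.Nullary using (¬_; Dec; yes; no; does; ¬?)
open import Relation.Nullary.Decidable using (dec-true; dec-false; does-⇔; _⊎-dec_)

-- Ordered fields and real closure

-- `Prob α` is a sum over subsets of `B[ α ]`, so its form depends on the symbols occurring in `α`,
-- while Q relates each formula to conjuncts over all of `B⋃ αs`. The measure of an event depends on
-- no such choice, which is why the equations of Q are moved to measures before they are proved. The
-- argument is constructive, and the two notions of truth have different shapes: `Satisfies` reads
-- an implication as a sum type, `Holds` as a function type with conjunction and disjunction encoded
-- by negation. Trichotomy decides the atomic statements, and this lets constraints pass from one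
-- notion to the other.

module OrderedFieldProperties (K : OrderedField) where
  open OrderedField K
  open IsStrictTotalOrder isStrictTotalOrder
    using (irrefl; asym; <-respˡ-≈; <-respʳ-≈)
    renaming (compare to trichotomy; isStrictPartialOrder to isSPO)
  open RingProperties ring
    using (-‿involutive; -‿distribˡ-*; -‿distribʳ-*; -0#≈0#)
  open AbelianGroupProperties +-abelianGroup using () renaming (⁻¹-∙-comm to -‿+-comm)
  open Exponentiation semiring using (_^_; ^-assocʳ; ^-congˡ)
  open SemiringSolver commutativeSemiring using (solve; _:+_; _:*_; con; _:=_)

  strictPartialOrder : StrictPartialOrder 0ℓ 0ℓ 0ℓ
  strictPartialOrder = record { isStrictPartialOrder = isSPO }

  open StrictReasoning strictPartialOrder

  ≤-refl : ∀ {x} → x ≤ x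
  ≤-refl = inj₂ refl

  ≤⇒≯ : ∀ {x y} → x ≤ y → ¬ y < x
  ≤⇒≯ (inj₁ x<y) y<x = asym x<y y<x
  ≤⇒≯ (inj₂ x≈y) y<x = irrefl (sym x≈y) y<x

  ≮⇒≥ : ∀ {x y} → ¬ x < y → y ≤ x
  ≮⇒≥ {x} {y} x≮y with trichotomy x y
  ... | tri< x<y _ _ = ⊥-elim (x≮y x<y)
  ... | tri≈ _ x≈y _ = inj₂ (sym x≈y)
  ... | tri> _ _ y<x = inj₁ y<x

  +-monoʳ-< : ∀ z {x y} → x < y → z + x < z + y
  +-monoʳ-< z {x} {y} x<y = begin-strict
    z + x ≈⟨ +-comm z x ⟩
    x + z <⟨ +-monoˡ-< z x<y ⟩
    y + z ≈⟨ +-comm y z ⟩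
    z + y ∎

  +-monoˡ-≤ : ∀ z {x y} → x ≤ y → x + z ≤ y + z
  +-monoˡ-≤ z (inj₁ x<y) = inj₁ (+-monoˡ-< z x<y)
  +-monoˡ-≤ z (inj₂ x≈y) = inj₂ (+-congʳ x≈y)

  +-monoʳ-≤ : ∀ z {x y} → x ≤ y → z + x ≤ z + y
  +-monoʳ-≤ z (inj₁ x<y) = inj₁ (+-monoʳ-< z x<y)
  +-monoʳ-≤ z (inj₂ x≈y) = inj₂ (+-congˡ x≈y)

  +-mono-≤ : ∀ {x y z w} → x ≤ y → z ≤ w → x + z ≤ y + w
  +-mono-≤ {x} {y} {z} {w} x≤y z≤w = begin
    x + z ≤⟨ +-monoˡ-≤ z x≤y ⟩
    y + z ≤⟨ +-monoʳ-≤ y z≤w ⟩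
    y + w ∎

  x≤x+y : ∀ {x y} → 0# ≤ y → x ≤ x + y
  x≤x+y {x} {y} 0≤y = begin
    x      ≈⟨ +-identityʳ x ⟨
    x + 0# ≤⟨ +-monoʳ-≤ x 0≤y ⟩
    x + y  ∎

  x<x+y : ∀ {x y} → 0# < y → x < x + y
  x<x+y {x} {y} 0<y = begin-strict
    x      ≈⟨ +-identityʳ x ⟨
    x + 0# <⟨ +-monoʳ-< x 0<y ⟩
    x + y  ∎

  x+[y-x]≈y : ∀ x y → x + (y - x) ≈ y
  x+[y-x]≈y x y = begin-equality
    x + (y - x) ≈⟨ solve 3 (λ a b c → a :+ (b :+ c) := b :+ (a :+ c)) refl x y (- x) ⟩
    y + (x - x) ≈⟨ +-congˡ (-‿inverseʳ x) ⟩
    y + 0#      ≈⟨ +-identityʳ y ⟩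
    y           ∎

  x-y+y≈x : ∀ x y → x - y + y ≈ x
  x-y+y≈x x y = trans (+-comm (x - y) y) (x+[y-x]≈y y x)

  x<y⇒0<y-x : ∀ {x y} → x < y → 0# < y - x
  x<y⇒0<y-x {x} {y} x<y = begin-strict
    0#    ≈⟨ -‿inverseʳ x ⟨
    x - x <⟨ +-monoˡ-< (- x) x<y ⟩
    y - x ∎

  neg-mono-< : ∀ {x y} → x < y → - y < - x
  neg-mono-< {x} {y} x<y = begin-strict
    - y             ≈⟨ x+[y-x]≈y x (- y) ⟨
    x + (- y - x)   <⟨ +-monoˡ-< (- y - x) x<y ⟩
    y + (- y - x)   ≈⟨ +-congˡ (+-comm (- y) (- x)) ⟩
    y + (- x - y)   ≈⟨ x+[y-x]≈y y (- x) ⟩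
    - x             ∎

  neg-mono-≤ : ∀ {x y} → x ≤ y → - y ≤ - x
  neg-mono-≤ (inj₁ x<y) = inj₁ (neg-mono-< x<y)
  neg-mono-≤ (inj₂ x≈y) = inj₂ (-‿cong (sym x≈y))

  x<0⇒0<-x : ∀ {x} → x < 0# → 0# < - x
  x<0⇒0<-x {x} x<0 = <-respˡ-≈ -0#≈0# (neg-mono-< x<0)

  0<-x⇒x<0 : ∀ {x} → 0# < - x → x < 0#
  0<-x⇒x<0 {x} 0<-x = begin-strict
    x     ≈⟨ -‿involutive x ⟨
    - - x <⟨ neg-mono-< 0<-x ⟩
    - 0#  ≈⟨ -0#≈0# ⟩
    0#    ∎

  -x*-y≈x*y : ∀ x y → - x * - y ≈ x * y
  -x*-y≈x*y x y = begin-equality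
    - x * - y   ≈⟨ -‿distribˡ-* x (- y) ⟨
    - (x * - y) ≈⟨ -‿cong (-‿distribʳ-* x y) ⟨
    - - (x * y) ≈⟨ -‿involutive (x * y) ⟩
    x * y       ∎

  square-pos : ∀ {x} → ¬ (x ≈ 0#) → 0# < x * x
  square-pos {x} x≉0 with trichotomy x 0#
  ... | tri< x<0 _ _ = <-respʳ-≈ (-x*-y≈x*y x x) (*-pos (x<0⇒0<-x x<0) (x<0⇒0<-x x<0))
  ... | tri≈ _ x≈0 _ = ⊥-elim (x≉0 x≈0)
  ... | tri> _ _ 0<x = *-pos 0<x 0<x

  0<1 : 0# < 1#
  0<1 = <-respʳ-≈ (*-identityˡ 1#) (square-pos 1≉0)

  *-monoʳ-≤ : ∀ {z x y} → 0# ≤ z → x ≤ y → z * x ≤ z * y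
  *-monoʳ-≤ {z} {x} {y} (inj₁ 0<z) (inj₁ x<y) = begin
    z * x                 ≤⟨ x≤x+y (inj₁ (*-pos 0<z (x<y⇒0<y-x x<y))) ⟩
    z * x + z * (y - x)   ≈⟨ distribˡ z x (y - x) ⟨
    z * (x + (y - x))     ≈⟨ *-congˡ (x+[y-x]≈y x y) ⟩
    z * y                 ∎
  *-monoʳ-≤ {z} {x} {y} (inj₂ 0≈z) _ = inj₂ (begin-equality
    z * x  ≈⟨ *-congʳ 0≈z ⟨
    0# * x ≈⟨ zeroˡ x ⟩
    0#     ≈⟨ zeroˡ y ⟨
    0# * y ≈⟨ *-congʳ 0≈z ⟩
    z * y  ∎)
  *-monoʳ-≤ _ (inj₂ x≈y) = inj₂ (*-congˡ x≈y)

  *-monoˡ-≤ : ∀ {z x y} → 0# ≤ z → x ≤ y → x * z ≤ y * z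
  *-monoˡ-≤ {z} {x} {y} 0≤z x≤y = begin
    x * z ≈⟨ *-comm x z ⟩
    z * x ≤⟨ *-monoʳ-≤ 0≤z x≤y ⟩
    z * y ≈⟨ *-comm z y ⟩
    y * z ∎

  positive⇒≉0 : ∀ {x} → 0# < x → ¬ (x ≈ 0#)
  positive⇒≉0 0<x x≈0 = irrefl (sym x≈0) 0<x

  inverse-positive : ∀ {x y} → 0# < x → x * y ≈ 1# → 0# < y
  inverse-positive {x} {y} 0<x xy≈1 with trichotomy 0# y
  ... | tri< 0<y _ _ = 0<y
  ... | tri≈ _ 0≈y _ = ⊥-elim (1≉0 (begin-equality
    1#     ≈⟨ xy≈1 ⟨
    x * y  ≈⟨ *-congˡ 0≈y ⟨
    x * 0# ≈⟨ zeroʳ x ⟩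
    0#     ∎))
  ... | tri> _ _ y<0 = ⊥-elim (asym 0<1 (0<-x⇒x<0 (begin-strict
    0#        <⟨ *-pos 0<x (x<0⇒0<-x y<0) ⟩
    x * - y   ≈⟨ -‿distribʳ-* x y ⟨
    - (x * y) ≈⟨ -‿cong xy≈1 ⟩
    - 1#      ∎)))

  *-cancel-0 : ∀ {x y} → ¬ (x ≈ 0#) → x * y ≈ 0# → y ≈ 0#
  *-cancel-0 {x} {y} x≉0 xy≈0 with inverse x x≉0
  ... | x⁻¹ , xx⁻¹≈1 = begin-equality
    y               ≈⟨ *-identityˡ y ⟨
    1# * y          ≈⟨ *-congʳ xx⁻¹≈1 ⟨
    x * x⁻¹ * y     ≈⟨ solve 3 (λ a b c → a :* b :* c := a :* c :* b) refl x x⁻¹ y ⟩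
    x * y * x⁻¹     ≈⟨ *-congʳ xy≈0 ⟩
    0# * x⁻¹        ≈⟨ zeroˡ x⁻¹ ⟩
    0#              ∎

  -- |x| ≤ c
  Within : Carrier → Carrier → Set
  Within c x = x ≤ c × - x ≤ c

  within-0 : ∀ {c} → 0# ≤ c → Within c 0#
  within-0 {c} 0≤c = 0≤c , (begin
    - 0# ≈⟨ -0#≈0# ⟩
    0#   ≤⟨ 0≤c ⟩
    c    ∎)

  within-weaken : ∀ {c d x} → c ≤ d → Within c x → Within d x
  within-weaken {c} {d} {x} c≤d (x≤c , -x≤c) =
    (begin x ≤⟨ x≤c ⟩ c ≤⟨ c≤d ⟩ d ∎) , (begin - x ≤⟨ -x≤c ⟩ c ≤⟨ c≤d ⟩ d ∎)

  within-+ : ∀ {c d x y} → Within c x → Within d y → Within (c + d) (x + y)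
  within-+ {c} {d} {x} {y} (x≤c , -x≤c) (y≤d , -y≤d) = +-mono-≤ x≤c y≤d , (begin
    - (x + y) ≈⟨ -‿+-comm x y ⟨
    - x - y   ≤⟨ +-mono-≤ -x≤c -y≤d ⟩
    c + d     ∎)

  within⇒0≤ : ∀ {c x} → Within c x → 0# ≤ c
  within⇒0≤ {c} {x} (x≤c , -x≤c) with trichotomy 0# x
  ... | tri< 0<x _ _ = begin 0# <⟨ 0<x ⟩ x ≤⟨ x≤c ⟩ c ∎
  ... | tri≈ _ 0≈x _ = begin 0# ≈⟨ 0≈x ⟩ x ≤⟨ x≤c ⟩ c ∎
  ... | tri> _ _ x<0 = begin 0# <⟨ x<0⇒0<-x x<0 ⟩ - x ≤⟨ -x≤c ⟩ c ∎

  within⇒*≤ : ∀ {c d x y} → Within c x → Within d y → x * y ≤ c * d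
  within⇒*≤ {c} {d} {x} {y} (x≤c , -x≤c) w@(y≤d , -y≤d) with trichotomy x 0#
  ... | tri< x<0 _ _ = begin
    x * y     ≈⟨ -x*-y≈x*y x y ⟨
    - x * - y ≤⟨ *-monoʳ-≤ (inj₁ (x<0⇒0<-x x<0)) -y≤d ⟩
    - x * d   ≤⟨ *-monoˡ-≤ (within⇒0≤ w) -x≤c ⟩
    c * d     ∎
  ... | tri≈ _ x≈0 _ = begin
    x * y     ≤⟨ *-monoʳ-≤ (inj₂ (sym x≈0)) y≤d ⟩
    x * d     ≤⟨ *-monoˡ-≤ (within⇒0≤ w) x≤c ⟩
    c * d     ∎
  ... | tri> _ _ 0<x = begin
    x * y     ≤⟨ *-monoʳ-≤ (inj₁ 0<x) y≤d ⟩
    x * d     ≤⟨ *-monoˡ-≤ (within⇒0≤ w) x≤c ⟩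
    c * d     ∎

  within-neg : ∀ {c x} → Within c x → Within c (- x)
  within-neg {c} {x} (x≤c , -x≤c) = -x≤c , (begin
    - - x ≈⟨ -‿involutive x ⟩
    x     ≤⟨ x≤c ⟩
    c     ∎)

  within-* : ∀ {c d x y} → Within c x → Within d y → Within (c * d) (x * y)
  within-* {c} {d} {x} {y} wx wy = within⇒*≤ wx wy , (begin
    - (x * y) ≈⟨ -‿distribʳ-* x y ⟩
    x * - y   ≤⟨ within⇒*≤ wx (within-neg wy) ⟩
    c * d     ∎)

  magnitude : ∀ x → ∃ λ c → Within c x
  magnitude x with trichotomy 0# x
  ... | tri< 0<x _ _ = x , ≤-refl , (begin - x ≤⟨ neg-mono-≤ (inj₁ 0<x) ⟩ - 0# ≈⟨ -0#≈0# ⟩ 0# <⟨ 0<x ⟩ x ∎)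
  ... | tri≈ _ 0≈x _ = x , ≤-refl , (begin - x ≈⟨ -‿cong 0≈x ⟨ - 0# ≈⟨ -0#≈0# ⟩ 0# ≈⟨ 0≈x ⟩ x ∎)
  ... | tri> _ _ x<0 = - x , (begin x <⟨ x<0 ⟩ 0# <⟨ x<0⇒0<-x x<0 ⟩ - x ∎) , ≤-refl

  -- The increment of `f` is written as an error term `e`, so that the identities about it contain
  -- no subtraction and are within reach of a solver for semirings. The restriction `δ ≤ 1#` keeps
  -- `s + h` bounded, so that a single `C` can serve a polynomial.
  Lipschitz : (Carrier → Carrier) → Carrier → Set
  Lipschitz f s = ∃ λ C → ∀ δ h → δ ≤ 1# → Within δ h → ∃ λ e → Within (C * δ) e × f (s + h) ≈ f s + e

  scale-lipschitz : ∀ w f {s} → Lipschitz f s → Lipschitz (λ x → w * f x) s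
  scale-lipschitz w f {s} (C , lip) with magnitude w
  ... | c , within-c = c * C , λ δ h δ≤1 within-δ → scaled (lip δ h δ≤1 within-δ)
    where
    scaled : ∀ {δ h} → (∃ λ e → Within (C * δ) e × f (s + h) ≈ f s + e) →
             ∃ λ e → Within (c * C * δ) e × w * f (s + h) ≈ w * f s + e
    scaled {δ} {h} (e , within-e , fsh≈) =
      w * e ,
      within-weaken (inj₂ (sym (*-assoc c C δ))) (within-* within-c within-e) ,
      trans (*-congˡ fsh≈) (distribˡ w (f s) e)

  polynomial-cong : ∀ {n} (as : Vec Carrier n) {x y} → x ≈ y → polynomial as x ≈ polynomial as y
  polynomial-cong []       x≈y = refl
  polynomial-cong (a ∷ as) x≈y = +-congˡ (*-cong x≈y (polynomial-cong as x≈y))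

  polynomial-lipschitz : ∀ {n} (as : Vec Carrier n) s → Lipschitz (polynomial as) s
  polynomial-lipschitz [] s =
    0# , λ δ h _ _ → 0# , within-0 (inj₂ (sym (zeroˡ δ))) , sym (+-identityʳ 0#)
  polynomial-lipschitz (a ∷ as) s
    with polynomial-lipschitz as s | magnitude s | magnitude (polynomial as s)
  ... | C , lip | c , within-c | d , within-d =
    -- The new error is `(s + h) * e + r * h`. Here `c + 1#` bounds `s + h` because `δ ≤ 1#`,
    -- `C * δ` bounds `e`, and `d` bounds the value `r` of the tail polynomial.
    (c + 1#) * C + d , λ δ h δ≤1 within-δ → step δ≤1 within-δ (lip δ h δ≤1 within-δ)
    where
    r = polynomial as s
    step : ∀ {δ h} → δ ≤ 1# → Within δ h →
           (∃ λ e → Within (C * δ) e × polynomial as (s + h) ≈ r + e) →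
           ∃ λ e → Within (((c + 1#) * C + d) * δ) e ×
                   a + (s + h) * polynomial as (s + h) ≈ (a + s * r) + e
    step {δ} {h} δ≤1 within-δ (e , within-e , rsh≈) =
      (s + h) * e + r * h ,
      within-weaken
        (inj₂ (solve 4 (λ c C d δ → (c :+ con 1) :* (C :* δ) :+ d :* δ := ((c :+ con 1) :* C :+ d) :* δ)
                       refl c C d δ))
        (within-+ (within-* (within-+ within-c (within-weaken δ≤1 within-δ)) within-e)
                  (within-* within-d within-δ)) ,
      (begin-equality
        a + (s + h) * polynomial as (s + h) ≈⟨ +-congˡ (*-congˡ rsh≈) ⟩
        a + (s + h) * (r + e)               ≈⟨ solve 5 (λ a s h r e →
          a :+ (s :+ h) :* (r :+ e) := (a :+ s :* r) :+ ((s :+ h) :* e :+ r :* h)) refl a s h r e ⟩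
        (a + s * r) + ((s + h) * e + r * h) ∎)

  small-multiple : ∀ C {y} → 0# < y → ∃ λ δ → 0# < δ × δ ≤ 1# × C * δ < y
  small-multiple C {y} 0<y with trichotomy 0# C
  ... | tri≈ _ 0≈C _ = 1# , 0<1 , ≤-refl , (begin-strict C * 1# ≈⟨ *-identityʳ C ⟩ C ≈⟨ 0≈C ⟨ 0# <⟨ 0<y ⟩ y ∎)
  ... | tri> _ _ C<0 = 1# , 0<1 , ≤-refl , (begin-strict C * 1# ≈⟨ *-identityʳ C ⟩ C <⟨ C<0 ⟩ 0# <⟨ 0<y ⟩ y ∎)
  ... | tri< 0<C _ _ = δ , 0<δ , δ≤1 , (begin-strict
      C * δ           <⟨ x<x+y (*-pos 0<y 0<δ) ⟩
      C * δ + y * δ   ≈⟨ distribʳ δ C y ⟨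
      (C + y) * δ     ≈⟨ [C+y]δ≈y ⟩
      y               ∎)
    where
    0<C+y : 0# < C + y
    0<C+y = begin-strict 0# <⟨ 0<C ⟩ C <⟨ x<x+y 0<y ⟩ C + y ∎
    i = proj₁ (inverse (C + y) (positive⇒≉0 0<C+y))
    [C+y]i≈1 = proj₂ (inverse (C + y) (positive⇒≉0 0<C+y))
    0<i = inverse-positive 0<C+y [C+y]i≈1
    -- This is `y / (C + y)`. The denominator exceeds both `C` and `y`: the former gives
    -- `C * δ < y`, the latter `δ ≤ 1#`.
    δ = y * i
    0<δ = *-pos 0<y 0<i
    [C+y]δ≈y : (C + y) * δ ≈ y
    [C+y]δ≈y = begin-equality
      (C + y) * (y * i) ≈⟨ solve 3 (λ a b c → a :* (b :* c) := b :* (a :* c)) refl (C + y) y i ⟩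
      y * ((C + y) * i) ≈⟨ *-congˡ [C+y]i≈1 ⟩
      y * 1#            ≈⟨ *-identityʳ y ⟩
      y                 ∎
    δ≤1 : δ ≤ 1#
    δ≤1 = begin
      y * i             ≤⟨ x≤x+y (inj₁ (*-pos 0<C 0<i)) ⟩
      y * i + C * i     ≈⟨ solve 3 (λ a b c → b :* c :+ a :* c := (a :+ b) :* c) refl C y i ⟩
      (C + y) * i       ≈⟨ [C+y]i≈1 ⟩
      1#                ∎

  lipschitz⇒continuous : ∀ f {s} → Lipschitz f s → ∀ {y} → 0# < y →
    ∃ λ δ → 0# < δ × (∀ h → Within δ h → ∃ λ e → e < y × - e < y × f (s + h) ≈ f s + e)
  lipschitz⇒continuous f {s} (C , lip) {y} 0<y with small-multiple C 0<y
  ... | δ , 0<δ , δ≤1 , Cδ<y = δ , 0<δ , λ h within-δ → near (lip δ h δ≤1 within-δ)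
    where
    near : ∀ {h} → (∃ λ e → Within (C * δ) e × f (s + h) ≈ f s + e) →
             ∃ λ e → e < y × - e < y × f (s + h) ≈ f s + e
    near (e , (e≤ , -e≤) , fsh≈) =
      e , (begin-strict e ≤⟨ e≤ ⟩ C * δ <⟨ Cδ<y ⟩ y ∎) ,
      (begin-strict - e ≤⟨ -e≤ ⟩ C * δ <⟨ Cδ<y ⟩ y ∎) , fsh≈

  -- The substitution x ↦ u x with u = ±1 covers both ends of the line at once.
  eventually-positive : ∀ {n} (as : Vec Carrier n) a u W → 0# < W * (u ^ n * a) →
    ∃ λ M → ∃ λ ε → 0# < ε × (∀ x → M ≤ x → ε ≤ W * polynomial (as ∷ʳᵛ a) (u * x))
  eventually-positive [] a u W 0<lead = 0# , W * (1# * a) , 0<lead , λ x _ →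
    inj₂ (solve 4 (λ W a u x → W :* (con 1 :* a) := W :* (a :+ u :* x :* con 0)) refl W a u x)
  eventually-positive {suc n} (b ∷ as) a u W 0<lead
    -- With q the tail polynomial, p(u x) = b + u x q(u x), so the factor `u` joins the weight of q.
    -- The induction carries a bound `ε` instead of mere positivity, since a tail known only to be
    -- positive need not outweigh `W * b`.
    with eventually-positive as a u (W * u)
           (<-respʳ-≈ (solve 4 (λ W u p a → W :* (u :* p :* a) := W :* u :* (p :* a)) refl W u (u ^ n) a) 0<lead)
  ... | M′ , ε , 0<ε , ev = c + d , 1# , 0<1 , λ x M≤x → lower-bound x M≤x
    where
    i = proj₁ (inverse ε (positive⇒≉0 0<ε))
    εi≈1 = proj₂ (inverse ε (positive⇒≉0 0<ε))
    -- This `k` solves `W * b + k * ε ≈ 1#`. The threshold `c + d`, a sum of bounds for the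
    -- magnitudes of `M′` and `k`, stands in for the maximum of `M′`, `k` and 0.
    k = (1# - W * b) * i
    c = proj₁ (magnitude M′)
    d = proj₁ (magnitude k)
    within-c = proj₂ (magnitude M′)
    within-d = proj₂ (magnitude k)
    lower-bound : ∀ x → c + d ≤ x → 1# ≤ W * (b + u * x * polynomial (as ∷ʳᵛ a) (u * x))
    lower-bound x M≤x = begin
      1#                            ≈⟨ x+[y-x]≈y (W * b) 1# ⟨
      W * b + (1# - W * b)          ≈⟨ +-congˡ (*-identityʳ _) ⟨
      W * b + (1# - W * b) * 1#     ≈⟨ +-congˡ (*-congˡ εi≈1) ⟨
      W * b + (1# - W * b) * (ε * i) ≈⟨ solve 4 (λ q p e j →
          q :+ p :* (e :* j) := q :+ p :* j :* e) refl (W * b) (1# - W * b) ε i ⟩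
      W * b + k * ε                 ≤⟨ +-monoʳ-≤ (W * b) (*-monoˡ-≤ (inj₁ 0<ε) k≤x) ⟩
      W * b + x * ε                 ≤⟨ +-monoʳ-≤ (W * b) (*-monoʳ-≤ 0≤x (ev x M′≤x)) ⟩
      W * b + x * (W * u * r)       ≈⟨ solve 5 (λ W b x u r →
          W :* b :+ x :* (W :* u :* r) := W :* (b :+ u :* x :* r)) refl W b x u r ⟩
      W * (b + u * x * r)           ∎
      where
      r = polynomial (as ∷ʳᵛ a) (u * x)
      c≤x : c ≤ x
      c≤x = begin c ≤⟨ x≤x+y (within⇒0≤ within-d) ⟩ c + d ≤⟨ M≤x ⟩ x ∎
      M′≤x : M′ ≤ x
      M′≤x = begin M′ ≤⟨ proj₁ within-c ⟩ c ≤⟨ c≤x ⟩ x ∎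
      0≤x : 0# ≤ x
      0≤x = begin 0# ≤⟨ within⇒0≤ within-c ⟩ c ≤⟨ c≤x ⟩ x ∎
      k≤x : k ≤ x
      k≤x = begin k ≤⟨ proj₁ within-d ⟩ d ≤⟨ x≤x+y (within⇒0≤ within-c) ⟩ d + c ≈⟨ +-comm d c ⟩ c + d ≤⟨ M≤x ⟩ x ∎

  1^n≈1 : ∀ n → 1# ^ n ≈ 1#
  1^n≈1 zero    = refl
  1^n≈1 (suc n) = trans (*-identityˡ _) (1^n≈1 n)

  [-1]^[1+2n]≈-1 : ∀ n → (- 1#) ^ suc (2 ℕ.* n) ≈ - 1#
  [-1]^[1+2n]≈-1 n = begin-equality
    - 1# * (- 1#) ^ (2 ℕ.* n)            ≈⟨ *-congˡ (^-assocʳ (- 1#) 2 n) ⟨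
    - 1# * (- 1# * (- 1# * 1#)) ^ n    ≈⟨ *-congˡ (^-congˡ n (trans (*-congˡ (*-identityʳ _)) (-x*-y≈x*y 1# 1#))) ⟩
    - 1# * (1# * 1#) ^ n               ≈⟨ *-congˡ (^-congˡ n (*-identityˡ 1#)) ⟩
    - 1# * 1# ^ n                      ≈⟨ *-congˡ (1^n≈1 n) ⟩
    - 1# * 1#                          ≈⟨ *-identityʳ (- 1#) ⟩
    - 1#                               ∎

-- Dedekind complete ordered fields: intermediate values, real closure, limits

module RealsProperties (ℝ : Reals) where
  open Reals ℝ
  open OrderedFieldProperties orderedField
  open IsStrictTotalOrder isStrictTotalOrder
    using (irrefl; asym; <-respʳ-≈)
    renaming (compare to trichotomy)
  open RingProperties ring using (-‿distribˡ-*; -0#≈0#; -1*x≈-x)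
  open AbelianGroupProperties +-abelianGroup using (⁻¹-anti-homo‿-; xyx⁻¹≈y)
  open Exponentiation semiring using (_^_)
  open StrictReasoning strictPartialOrder

  -- Positivity beyond `M` bounds the set on which the supremum `s` is taken. A negative value at
  -- `s` would persist at `s + δ`, above the upper bound; a positive one would persist down to
  -- `s - δ`, which would then be a smaller upper bound.
  intermediate-value : ∀ f → (∀ {x y} → x ≈ y → f x ≈ f y) → (∀ s → Lipschitz f s) →
    ∃ (λ x → f x < 0#) → ∃ (λ M → ∀ x → M ≤ x → 0# < f x) → ∃ λ x → f x ≈ 0#
  intermediate-value f f-cong lip neg (M , pos)
    with supremum (λ x → f x < 0#) neg (M , λ x fx<0 → ≮⇒≥ (λ M<x → asym fx<0 (pos x (inj₁ M<x))))
  ... | s , upper , least with trichotomy (f s) 0#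
  ...   | tri≈ _ fs≈0 _ = s , fs≈0
  ...   | tri< fs<0 _ _ = ⊥-elim (climb (lipschitz⇒continuous f (lip s) (x<0⇒0<-x fs<0)))
    where
    climb : ¬ (∃ λ δ → 0# < δ × (∀ h → Within δ h → ∃ λ e → e < - f s × - e < - f s × f (s + h) ≈ f s + e))
    climb (δ , 0<δ , near) with near δ (≤-refl , (begin - δ <⟨ neg-mono-< 0<δ ⟩ - 0# ≈⟨ -0#≈0# ⟩ 0# <⟨ 0<δ ⟩ δ ∎))
    ... | e , e<-fs , _ , fsδ≈ = ≤⇒≯ (upper (s + δ) (begin-strict
            f (s + δ)  ≈⟨ fsδ≈ ⟩
            f s + e    <⟨ +-monoʳ-< (f s) e<-fs ⟩
            f s - f s  ≈⟨ -‿inverseʳ (f s) ⟩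
            0#         ∎)) (x<x+y 0<δ)
  ...   | tri> _ _ 0<fs = ⊥-elim (descend (lipschitz⇒continuous f (lip s) 0<fs))
    where
    descend : ¬ (∃ λ δ → 0# < δ × (∀ h → Within δ h → ∃ λ e → e < f s × - e < f s × f (s + h) ≈ f s + e))
    descend (δ , 0<δ , near) = ≤⇒≯ (least (s - δ) below) (begin-strict
        s - δ       <⟨ x<x+y 0<δ ⟩
        s - δ + δ   ≈⟨ x-y+y≈x s δ ⟩
        s           ∎)
      where
      below : IsUpperBound (λ x → f x < 0#) (s - δ)
      below x fx<0 = ≮⇒≥ λ s-δ<x → absurd s-δ<x
        where
        absurd : ¬ (s - δ < x)
        absurd s-δ<x with near (x - s)
          ((begin x - s ≤⟨ +-monoˡ-≤ (- s) (upper x fx<0) ⟩ s - s ≈⟨ -‿inverseʳ s ⟩ 0# <⟨ 0<δ ⟩ δ ∎) ,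
           (begin - (x - s)          ≈⟨ ⁻¹-anti-homo‿- x s ⟩
                  s - x              ≈⟨ +-congʳ (x-y+y≈x s δ) ⟨
                  s - δ + δ - x      ≤⟨ +-monoˡ-≤ (- x) (+-monoˡ-≤ δ (inj₁ s-δ<x)) ⟩
                  x + δ - x          ≈⟨ xyx⁻¹≈y x δ ⟩
                  δ                  ∎))
        ... | e , _ , -e<fs , fsh≈ = asym fx<0 (begin-strict
          0#                ≈⟨ -‿inverseˡ e ⟨
          - e + e           <⟨ +-monoˡ-< e -e<fs ⟩
          f s + e           ≈⟨ fsh≈ ⟨
          f (s + (x - s))   ≈⟨ f-cong (x+[y-x]≈y s x) ⟩
          f x               ∎)

  -- The weight `w` turns the leading coefficient positive, so one orientation of the intermediate
  -- value argument covers both signs of `a`. It is nonzero because `w * a` is, hence it cancels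
  -- from the equation for the root.
  polynomial-root : ∀ {n} (as : Vec Carrier n) a w → 0# < w * a →
    ∃ (λ x → w * polynomial (as ∷ʳᵛ a) x < 0#) → ∃ λ x → polynomial (as ∷ʳᵛ a) x ≈ 0#
  polynomial-root {n} as a w 0<wa neg with eventually-positive as a 1# w
    (<-respʳ-≈ (*-congˡ (sym (trans (*-congʳ (1^n≈1 n)) (*-identityˡ a)))) 0<wa)
  ... | M , ε , 0<ε , ev with intermediate-value (λ x → w * p x) (λ x≈y → *-congˡ (polynomial-cong (as ∷ʳᵛ a) x≈y))
          (λ s → scale-lipschitz w (polynomial (as ∷ʳᵛ a)) (polynomial-lipschitz (as ∷ʳᵛ a) s)) neg
          (M , λ x M≤x → begin-strict
            0#             <⟨ 0<ε ⟩
            ε              ≤⟨ ev x M≤x ⟩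
            w * p (1# * x) ≈⟨ *-congˡ (polynomial-cong (as ∷ʳᵛ a) (*-identityˡ x)) ⟩
            w * p x        ∎)
    where p = polynomial (as ∷ʳᵛ a)
  ...   | x , wpx≈0 = x , *-cancel-0 (λ w≈0 → irrefl (sym (trans (*-congʳ w≈0) (zeroˡ a))) 0<wa) wpx≈0

  square-root : ∀ a → 0# < a → ∃ λ y → y * y ≈ a
  square-root a 0<a = y , (begin-equality
      y * y                                         ≈⟨ x+[y-x]≈y a (y * y) ⟨
      a + (y * y - a)                               ≈⟨ +-congˡ (+-comm (y * y) (- a)) ⟩
      a + (- a + y * y)                             ≈⟨ +-congˡ (+-congˡ (*-congˡ (monic y))) ⟨
      a + (- a + y * (0# + y * (1# + y * 0#)))      ≈⟨ +-congˡ root ⟩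
      a + 0#                                        ≈⟨ +-identityʳ a ⟩
      a                                             ∎)
    where
    monic : ∀ x → 0# + x * (1# + x * 0#) ≈ x
    monic x = begin-equality
      0# + x * (1# + x * 0#) ≈⟨ +-identityˡ _ ⟩
      x * (1# + x * 0#)      ≈⟨ *-congˡ (+-congˡ (zeroʳ x)) ⟩
      x * (1# + 0#)          ≈⟨ *-congˡ (+-identityʳ 1#) ⟩
      x * 1#                 ≈⟨ *-identityʳ x ⟩
      x                      ∎
    at-0 : 1# * polynomial ((- a ∷ 0# ∷ []) ∷ʳᵛ 1#) 0# < 0#
    at-0 = begin-strict
      1# * (- a + 0# * _) ≈⟨ *-identityˡ _ ⟩
      - a + 0# * _        ≈⟨ +-congˡ (zeroˡ _) ⟩
      - a + 0#            ≈⟨ +-identityʳ (- a) ⟩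
      - a                 <⟨ neg-mono-< 0<a ⟩
      - 0#                ≈⟨ -0#≈0# ⟩
      0#                  ∎
    zero-of-x²-a : ∃ λ x → polynomial ((- a ∷ 0# ∷ []) ∷ʳᵛ 1#) x ≈ 0#
    zero-of-x²-a = polynomial-root (- a ∷ 0# ∷ []) 1# 1# (<-respʳ-≈ (sym (*-identityˡ 1#)) 0<1) (0# , at-0)
    y = proj₁ zero-of-x²-a
    root = proj₂ zero-of-x²-a

  -- With weight `- a` and direction `- 1#` the leading coefficient becomes `a * a`, because an odd
  -- power of `- 1#` is `- 1#`. Hence `a` times the polynomial is negative far to the left; far to
  -- the right it is positive, its leading coefficient being `a * a` again.
  odd-root : ∀ n (as : Vec Carrier (suc (2 ℕ.* n))) a → ¬ (a ≈ 0#) →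
             ∃ λ x → polynomial (as ∷ʳᵛ a) x ≈ 0#
  odd-root n as a a≉0 with eventually-positive as a (- 1#) (- a) (begin-strict
    0#                                 <⟨ square-pos a≉0 ⟩
    a * a                              ≈⟨ -x*-y≈x*y a a ⟨
    - a * - a                          ≈⟨ *-congˡ (-1*x≈-x a) ⟨
    - a * (- 1# * a)                   ≈⟨ *-congˡ (*-congʳ ([-1]^[1+2n]≈-1 n)) ⟨
    - a * ((- 1#) ^ suc (2 ℕ.* n) * a)   ∎)
  ... | M , ε , 0<ε , ev = polynomial-root as a a (square-pos a≉0)
    (- 1# * M , 0<-x⇒x<0 (begin-strict
      0#              <⟨ 0<ε ⟩
      ε               ≤⟨ ev M ≤-refl ⟩
      - a * p         ≈⟨ -‿distribˡ-* a p ⟨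
      - (a * p)       ∎))
    where p = polynomial (as ∷ʳᵛ a) (- 1# * M)

  realClosedField : RealClosedField
  realClosedField = record { orderedField = orderedField ; sqrt = square-root ; oddRoot = odd-root }

  limit-eventually-constant : ∀ {s l c} → Converges s l → ∀ k → (∀ n → s (k ℕ.+ n) ≈ c) → l ≈ c
  limit-eventually-constant {s} {l} {c} s→l k s≈c with trichotomy l c
  ... | tri≈ _ l≈c _ = l≈c
  ... | tri< l<c _ _ with s→l (c - l) (x<y⇒0<y-x l<c)
  -- The index `k + N` lies in the constant range and beyond `N` at once, and there the difference
  -- equals the whole tolerance.
  ...   | N , close = ⊥-elim (irrefl (+-congʳ (s≈c N)) (proj₁ (close (k ℕ.+ N) (m≤n+m N k))))
  limit-eventually-constant {s} {l} {c} s→l k s≈c | tri> _ _ c<l with s→l (l - c) (x<y⇒0<y-x c<l)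
  ...   | N , close = ⊥-elim (irrefl (+-congˡ (-‿cong (s≈c N))) (proj₂ (close (k ℕ.+ N) (m≤n+m N k))))

-- Classical propositional logic

⊩-~⁺ : ∀ {v} α → ¬ v ⊩ᶜ α → v ⊩ᶜ ~ α
⊩-~⁺ α ¬α = cong not (Bool.¬-not ¬α)

⊩-~⁻ : ∀ {v} α → v ⊩ᶜ ~ α → ¬ v ⊩ᶜ α
⊩-~⁻ {v} α v⊩~α v⊩α with value v α
⊩-~⁻ α () ≡.refl | true

⊩-∨⁺ˡ : ∀ {v} α β → v ⊩ᶜ α → v ⊩ᶜ α ∨ᶜ β
⊩-∨⁺ˡ {v} α β v⊩α with value v α
... | true = ≡.refl

⊩-∨⁺ʳ : ∀ {v} α β → v ⊩ᶜ β → v ⊩ᶜ α ∨ᶜ β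
⊩-∨⁺ʳ {v} α β v⊩β with value v α
... | true  = ≡.refl
... | false = v⊩β

⊩-∨⁻ : ∀ {v} α β → v ⊩ᶜ α ∨ᶜ β → v ⊩ᶜ α ⊎ v ⊩ᶜ β
⊩-∨⁻ {v} α β v⊩ with value v α
... | true  = inj₁ ≡.refl
... | false = inj₂ v⊩

⊩-∧⁺ : ∀ {v} α β → v ⊩ᶜ α → v ⊩ᶜ β → v ⊩ᶜ α ∧ᶜ β
⊩-∧⁺ {v} α β v⊩α v⊩β with value v α | value v β
... | true | true = ≡.refl

⊩-∧⁻ : ∀ {v} α β → v ⊩ᶜ α ∧ᶜ β → v ⊩ᶜ α × v ⊩ᶜ β
⊩-∧⁻ {v} α β v⊩ with value v α | value v β
⊩-∧⁻ α β v⊩ | true  | true  = ≡.refl , ≡.refl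
⊩-∧⁻ α β () | true  | false
⊩-∧⁻ α β () | false | _

⊩-⊃⁻ : ∀ {v} α β → v ⊩ᶜ α ⊃ β → v ⊩ᶜ α → v ⊩ᶜ β
⊩-⊃⁻ {v} α β v⊩ v⊩α with value v α
... | true = v⊩

⊩-⊃⁺ : ∀ {v} α β → (v ⊩ᶜ α → v ⊩ᶜ β) → v ⊩ᶜ α ⊃ β
⊩-⊃⁺ {v} α β α⇒β with value v α
... | true  = α⇒β ≡.refl
... | false = ≡.refl

⊨tt : ⊨ᶜ tt
⊨tt v with v 1
... | true  = ≡.refl
... | false = ≡.refl

⊭ff : ∀ {v} → ¬ v ⊩ᶜ ff
⊭ff {v} v⊩ff = ⊩-~⁻ {v} tt v⊩ff (⊨tt v)

⊩-⋁⁺ : ∀ {v} {αs} → Any (v ⊩ᶜ_) αs → v ⊩ᶜ ⋁ᶜ αs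
⊩-⋁⁺ {v} {α ∷ αs} (here p)  = ⊩-∨⁺ˡ {v} α (⋁ᶜ αs) p
⊩-⋁⁺ {v} {α ∷ αs} (there p) = ⊩-∨⁺ʳ {v} α (⋁ᶜ αs) (⊩-⋁⁺ p)

⊩-⋁⁻ : ∀ {v} αs → v ⊩ᶜ ⋁ᶜ αs → Any (v ⊩ᶜ_) αs
⊩-⋁⁻ {v} []       v⊩ = ⊥-elim (⊭ff {v} v⊩)
⊩-⋁⁻ {v} (α ∷ αs) v⊩ with ⊩-∨⁻ {v} α (⋁ᶜ αs) v⊩
... | inj₁ p = here p
... | inj₂ p = there (⊩-⋁⁻ αs p)

⊩-literals⁺ : ∀ {v αs} → All (v ⊩ᶜ_) αs → v ⊩ᶜ literals αs
⊩-literals⁺ {v} []           = ⊨tt v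
⊩-literals⁺ (p ∷ [])     = p
⊩-literals⁺ {v} {α ∷ β ∷ αs} (p ∷ ps@(_ ∷ _)) =
  ⊩-∧⁺ {v} α (literals (β ∷ αs)) p (⊩-literals⁺ ps)

⊩-literals⁻ : ∀ {v} αs → v ⊩ᶜ literals αs → All (v ⊩ᶜ_) αs
⊩-literals⁻ []           _  = []
⊩-literals⁻ (α ∷ [])     v⊩ = v⊩ ∷ []
⊩-literals⁻ {v} (α ∷ αs@(_ ∷ _)) v⊩ = proj₁ split ∷ ⊩-literals⁻ αs (proj₂ split)
  where split = ⊩-∧⁻ {v} α (literals αs) v⊩

exclusive : ∀ α β → (∀ v → v ⊩ᶜ α → ¬ v ⊩ᶜ β) → ⊨ᶜ ~ (α ∧ᶜ β)
exclusive α β disjoint v =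
  ⊩-~⁺ {v} (α ∧ᶜ β) λ v⊩ → disjoint v (proj₁ (⊩-∧⁻ {v} α β v⊩)) (proj₂ (⊩-∧⁻ {v} α β v⊩))

exclusive⁻ : ∀ α β → ⊨ᶜ ~ (α ∧ᶜ β) → ∀ v → v ⊩ᶜ α → ¬ v ⊩ᶜ β
exclusive⁻ α β excl v v⊩α v⊩β = ⊩-~⁻ {v} (α ∧ᶜ β) (excl v) (⊩-∧⁺ {v} α β v⊩α v⊩β)

-- Subsets of a finite set of symbols and their conjunctions of literals

Agrees : List ℕ → Valuation → Valuation → Set
Agrees A v w = All (λ j → v j ≡ w j) A

module _ (A U : List ℕ) where

  negated : List ℕ
  negated = filter (λ j → ¬? (j ∈? U)) A

  ⊩φ⁻ : ∀ {v} → v ⊩ᶜ φ[ A , U ] → Agrees A v ⟨ U ⟩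
  ⊩φ⁻ {v} v⊩ = All.tabulate agrees
    where
    -- The formula `φ[ A , U ]` is defined by cases on the emptiness of both lists of literals; it
    -- can be taken apart only after the same case split.
    both : v ⊩ᶜ φ[ A , U ] → All (v ⊩ᶜ_) (map B U) × All (v ⊩ᶜ_) (map (~_ ∘ B) negated)
    both v⊩ with map B U | map (~_ ∘ B) negated
    ... | []      | neg     = [] , ⊩-literals⁻ neg v⊩
    ... | p ∷ pos | []      = ⊩-literals⁻ (p ∷ pos) v⊩ , []
    ... | p ∷ pos | n ∷ neg with ⊩-∧⁻ {v} (literals (p ∷ pos)) (literals (n ∷ neg)) v⊩
    ...   | v⊩pos , v⊩neg = ⊩-literals⁻ (p ∷ pos) v⊩pos , ⊩-literals⁻ (n ∷ neg) v⊩neg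
    agrees : ∀ {j} → j ∈ A → v j ≡ ⟨ U ⟩ j
    agrees {j} j∈A with j ∈? U
    ... | yes j∈U = All.lookup (All.map⁻ (proj₁ (both v⊩))) j∈U
    ... | no  j∉U = Bool.¬-not (⊩-~⁻ {v} (B j)
                      (All.lookup (All.map⁻ (proj₂ (both v⊩))) (∈-filter⁺ (λ j → ¬? (j ∈? U)) j∈A j∉U)))

  -- The inclusion of `U` in `A` matters because the positive literals range over all of `U`, while
  -- the agreement speaks only of `A`.
  ⊩φ⁺ : ∀ {v} → (∀ {j} → j ∈ U → j ∈ A) → Agrees A v ⟨ U ⟩ → v ⊩ᶜ φ[ A , U ]
  ⊩φ⁺ {v} U⊆A agrees = both (All.map⁺ (All.tabulate pos)) (All.map⁺ (All.tabulate neg))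
    where
    pos : ∀ {j} → j ∈ U → v ⊩ᶜ B j
    pos {j} j∈U = ≡.trans (All.lookup agrees (U⊆A j∈U)) (dec-true (j ∈? U) j∈U)
    neg : ∀ {j} → j ∈ negated → v ⊩ᶜ ~ B j
    neg {j} j∈ with ∈-filter⁻ (λ j → ¬? (j ∈? U)) {xs = A} j∈
    ... | j∈A , j∉U = cong not (≡.trans (All.lookup agrees j∈A) (dec-false (j ∈? U) j∉U))
    both : All (v ⊩ᶜ_) (map B U) → All (v ⊩ᶜ_) (map (~_ ∘ B) negated) → v ⊩ᶜ φ[ A , U ]
    both v⊩pos v⊩neg with map B U | map (~_ ∘ B) negated
    ... | []      | neg     = ⊩-literals⁺ v⊩neg
    ... | p ∷ pos | []      = ⊩-literals⁺ v⊩pos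
    ... | p ∷ pos | n ∷ neg =
      ⊩-∧⁺ {v} (literals (p ∷ pos)) (literals (n ∷ neg)) (⊩-literals⁺ v⊩pos) (⊩-literals⁺ v⊩neg)

∩-∈-subsets : ∀ v A → v ∩ A ∈ subsets A
∩-∈-subsets v [] = here ≡.refl
∩-∈-subsets v (j ∷ A) with v j
... | true  = ∈-++⁺ˡ (∈-map⁺ (j ∷_) (∩-∈-subsets v A))
... | false = ∈-++⁺ʳ (map (j ∷_) (subsets A)) (∩-∈-subsets v A)

subset-⊆ : ∀ A {U} → U ∈ subsets A → ∀ {j} → j ∈ U → j ∈ A
subset-⊆ []      (here ≡.refl) ()
subset-⊆ (i ∷ A) U∈ j∈U with ∈-++⁻ (map (i ∷_) (subsets A)) U∈
... | inj₂ U∈A = there (subset-⊆ A U∈A j∈U)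
... | inj₁ iU∈ with ∈-map⁻ (i ∷_) iU∈
...   | U′ , U′∈A , ≡.refl with j∈U
...     | here j≡i   = here j≡i
...     | there j∈U′ = there (subset-⊆ A U′∈A j∈U′)

-- A list in `subsets A` is thus recovered from its membership function, so different lists induce
-- different restrictions to `A`. Repetitions in `A` would break this: filtering `i ∷ i ∷ []` by
-- membership in `i ∷ []` keeps both copies.
subset-fixed : ∀ {A U} → Unique A → U ∈ subsets A → ⟨ U ⟩ ∩ A ≡ U
subset-fixed {[]} _ (here ≡.refl) = ≡.refl
subset-fixed {i ∷ A} (i∉A ∷ unique) U∈ with ∈-++⁻ (map (i ∷_) (subsets A)) U∈
subset-fixed {i ∷ A} {U} (i∉A ∷ unique) U∈ | inj₂ U∈A
  rewrite dec-false (i ∈? U) (λ i∈U → All.lookup i∉A (subset-⊆ A U∈A i∈U) ≡.refl) =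
  subset-fixed unique U∈A
... | inj₁ iU∈ with ∈-map⁻ (i ∷_) iU∈
...   | U′ , U′∈A , ≡.refl rewrite dec-true (i ∈? (i ∷ U′)) (here ≡.refl) =
  cong (i ∷_) (≡.trans (∩-cong A same) (subset-fixed unique U′∈A))
  where
  same : ∀ {j} → j ∈ A → ⟨ i ∷ U′ ⟩ j ≡ ⟨ U′ ⟩ j
  same {j} j∈A = does-⇔ (mk⇔ tail there) (j ∈? (i ∷ U′)) (j ∈? U′)
    where
    tail : j ∈ i ∷ U′ → j ∈ U′
    tail (here ≡.refl)  = ⊥-elim (All.lookup i∉A j∈A ≡.refl)
    tail (there j∈U′) = j∈U′

subsets-unique : ∀ {A} → Unique A → Unique (subsets A)
subsets-unique [] = [] ∷ []
subsets-unique {j ∷ A} (j∉A ∷ unique) =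
  -- Lists of the first half contain `j`; those of the second are contained in `A`, which does not.
  -- So the halves share no list.
  Unique.++⁺ (Unique.map⁺ ∷-injectiveʳ (subsets-unique unique)) (subsets-unique unique) λ
    { (jU∈ , U∈A) → let _ , _ , U≡jU′ = ∈-map⁻ (j ∷_) jU∈ in
        All.lookup j∉A (subset-⊆ A U∈A (subst (j ∈_) (≡.sym U≡jU′) (here ≡.refl))) ≡.refl }

toSet-unique : ∀ js → Unique (toSet js)
toSet-unique js = Unique.filter⁺ (_∈? js) (Unique.upTo⁺ _)

-- A common model would agree on `A` with both sets, which would then cut out the same part of `A`.
φ-exclusive : ∀ A U U′ → ⟨ U ⟩ ∩ A ≢ ⟨ U′ ⟩ ∩ A → ⊨ᶜ ~ (φ[ A , U ] ∧ᶜ φ[ A , U′ ])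
φ-exclusive A U U′ U≢U′ = exclusive φ[ A , U ] φ[ A , U′ ] λ v v⊩φ v⊩φ′ →
  U≢U′ (∩-cong A λ j∈A → ≡.trans (≡.sym (All.lookup (⊩φ⁻ A U {v} v⊩φ) j∈A)) (All.lookup (⊩φ⁻ A U′ {v} v⊩φ′) j∈A))

restrict-distinct : ∀ {A Us} → Unique A → All (_∈ subsets A) Us → Unique Us →
  AllPairs (λ U U′ → ⟨ U ⟩ ∩ A ≢ ⟨ U′ ⟩ ∩ A) Us
restrict-distinct uniqueA []         []               = []
restrict-distinct uniqueA (U∈ ∷ Us∈) (U∉Us ∷ uniqueU) =
  All.zipWith (λ { (U≢U′ , U′∈) e →
      U≢U′ (≡.trans (≡.sym (subset-fixed uniqueA U∈)) (≡.trans e (subset-fixed uniqueA U′∈))) })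
    (U∉Us , Us∈)
  ∷ restrict-distinct uniqueA Us∈ uniqueU

φs-exclusive : ∀ {A Us} → Unique A → All (_∈ subsets A) Us → Unique Us →
  AllPairs (λ α β → ⊨ᶜ ~ (α ∧ᶜ β)) (map φ[ A ,_] Us)
φs-exclusive {A} uniqueA Us∈ uniqueU =
  AllPairs.map⁺ (AllPairs.map (λ {U} {U′} → φ-exclusive A U U′) (restrict-distinct uniqueA Us∈ uniqueU))

⊩φ∩ : ∀ v A → v ⊩ᶜ φ[ A , v ∩ A ]
⊩φ∩ v A = ⊩φ⁺ A (v ∩ A) {v} (subset-⊆ A (∩-∈-subsets v A)) (All.tabulate λ j∈A → ≡.sym (⟨∩⟩-agrees A j∈A))

⊨⋁φ : ∀ A → ⊨ᶜ ⋁ᶜ (map φ[ A ,_] (subsets A))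
⊨⋁φ A v = ⊩-⋁⁺ (Any.map⁺ (lose (∩-∈-subsets v A) (⊩φ∩ v A)))

models : L → List (List ℕ)
models α = filter _∈⟦ α ⟧? (subsets B[ α ])

-- With `models⁻`, this makes the conjunctions over `⟦ α ⟧` the full disjunctive normal form of `α`.
-- The disjunct satisfied by `v` is the one for `v ∩ B[ α ]`.
models⁺ : ∀ {v} α → v ⊩ᶜ α → v ⊩ᶜ ⋁ᶜ (map φ[ B[ α ] ,_] (models α))
models⁺ {v} α v⊩α = ⊩-⋁⁺ (Any.map⁺ (lose
  (∈-filter⁺ _∈⟦ α ⟧? (∩-∈-subsets v B[ α ]) (v , v⊩α , ≡.refl)) (⊩φ∩ v B[ α ])))

-- A satisfied disjunct belongs to some `U ≡ w ∩ B[ α ]` with `w ⊩ᶜ α`, and `v` agrees with `w` on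
-- the symbols of `α` by way of `⟨ U ⟩`.
models⁻ : ∀ {v} α → v ⊩ᶜ ⋁ᶜ (map φ[ B[ α ] ,_] (models α)) → v ⊩ᶜ α
models⁻ {v} α v⊩ with find (Any.map⁻ (⊩-⋁⁻ (map φ[ B[ α ] ,_] (models α)) v⊩))
... | U , U∈ , v⊩φ with ∈-filter⁻ _∈⟦ α ⟧? {xs = subsets B[ α ]} U∈
...   | _ , w , w⊩α , ≡.refl = ≡.trans (value-cong α λ j∈ →
          let j∈B = ∈-toSet (occurrences α) j∈ in
          ≡.trans (All.lookup (⊩φ⁻ B[ α ] U {v} v⊩φ) j∈B) (⟨∩⟩-agrees B[ α ] j∈B)) w⊩α

-- Probabilities of formulas

module EventProbability (ℝ : Reals) {ℓ f} (𝓥 : StochasticValuation ℝ ℓ f) where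
  open Reals ℝ
  open StochasticValuation 𝓥
  open OrderedFieldProperties orderedField
  open RealsProperties ℝ
  open StrictReasoning strictPartialOrder

  valuation : Ω → Valuation
  valuation ω j = V j ω

  event : L → Pred Ω ℓ
  event α ω = Lift ℓ (valuation ω ⊩ᶜ α)

  μ⟦_⟧ : L → Carrier
  μ⟦ α ⟧ = μ (event α)

  complement-measurable : ∀ α → 𝓕 (event α) → 𝓕 (event (~ α))
  complement-measurable α 𝓕α = 𝓕-resp-≐
    ((λ {ω} ¬α → lift (⊩-~⁺ {valuation ω} α (¬α ∘ lift))) ,
     (λ {ω} v⊩~α v⊩α → ⊥-elim (⊩-~⁻ {valuation ω} α (lower v⊩~α) (lower v⊩α))))
    (𝓕-complement 𝓕α)

  event-measurable : ∀ α → 𝓕 (event α)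
  event-measurable (B j)   = measurable j true
  event-measurable (~ α)   = complement-measurable α (event-measurable α)
  event-measurable (α ⊃ β) = 𝓕-resp-≐ ((λ {ω} → ⋃⇒⊃ {ω}) , (λ {ω} → ⊃⇒⋃ {ω})) (𝓕-union parts parts-measurable)
    where
    -- The σ-algebra is closed under unions of sequences, so the two events are padded to a sequence
    -- by repeating `event β`.
    parts : ℕ → Pred Ω ℓ
    parts zero    = event (~ α)
    parts (suc _) = event β
    parts-measurable : ∀ n → 𝓕 (parts n)
    parts-measurable zero    = complement-measurable α (event-measurable α)
    parts-measurable (suc _) = event-measurable β
    ⋃⇒⊃ : ∀ {ω} → ⋃ ℕ parts ω → event (α ⊃ β) ω
    ⋃⇒⊃ {ω} (zero  , lift ¬α) = lift (⊩-⊃⁺ {valuation ω} α β (⊥-elim ∘ ⊩-~⁻ {valuation ω} α ¬α))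
    ⋃⇒⊃ {ω} (suc _ , lift v⊩β) = lift (⊩-⊃⁺ {valuation ω} α β λ _ → v⊩β)
    ⊃⇒⋃ : ∀ {ω} → event (α ⊃ β) ω → ⋃ ℕ parts ω
    ⊃⇒⋃ {ω} (lift v⊩) with value (valuation ω) α Bool.≟ true
    ... | yes v⊩α = 1 , lift (⊩-⊃⁻ {valuation ω} α β v⊩ v⊩α)
    ... | no ¬v⊩α = 0 , lift (⊩-~⁺ {valuation ω} α ¬v⊩α)

  μ-⊩-cong : ∀ α β → (∀ v → v ⊩ᶜ α → v ⊩ᶜ β) → (∀ v → v ⊩ᶜ β → v ⊩ᶜ α) → μ⟦ α ⟧ ≈ μ⟦ β ⟧
  μ-⊩-cong α β α⇒β β⇒α = μ-cong (event-measurable α) (event-measurable β)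
    ((λ {ω} (lift p) → lift (α⇒β (valuation ω) p)) , (λ {ω} (lift p) → lift (β⇒α (valuation ω) p)))

  μ-ff : μ⟦ ff ⟧ ≈ 0#
  μ-ff = trans (μ-cong (event-measurable ff) (𝓕-resp-≐ empty (event-measurable ff)) empty) μ-empty
    where
    empty : event ff ≐ (λ _ → ⊥ℓ)
    empty = (λ {ω} (lift p) → ⊥-elim (⊭ff {valuation ω} p)) , λ ()

  μ-valid : ∀ α → ⊨ᶜ α → μ⟦ α ⟧ ≈ 1#
  μ-valid α ⊨α = trans (μ-cong (event-measurable α) 𝓕-whole ((λ _ → _) , (λ {ω} _ → lift (⊨α (valuation ω))))) μ-whole

  -- Finite additivity is drawn from σ-additivity by padding with `ff`: the partial sums are
  -- constant from index 2 on, which determines their limit. Indexing the events by formulas yields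
  -- their measurability at once.
  μ-∨ : ∀ α β → ⊨ᶜ ~ (α ∧ᶜ β) → μ⟦ α ∨ᶜ β ⟧ ≈ μ⟦ α ⟧ + μ⟦ β ⟧
  μ-∨ α β excl = trans (sym (μ-cong 𝓕⋃ (event-measurable (α ∨ᶜ β)) ((λ {ω} → ⋃⇒∨ {ω}) , (λ {ω} → ∨⇒⋃ {ω}))))
    (limit-eventually-constant (μ-σ-additive events (event-measurable ∘ formulas) (λ m n → disjoint m n)) 2 partial)
    where
    formulas : ℕ → L
    formulas zero          = α
    formulas (suc zero)    = β
    formulas (suc (suc _)) = ff
    events : ℕ → Pred Ω ℓ
    events n = event (formulas n)
    𝓕⋃ : 𝓕 (⋃ ℕ events)
    𝓕⋃ = 𝓕-union events (event-measurable ∘ formulas)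
    ⋃⇒∨ : ∀ {ω} → ⋃ ℕ events ω → event (α ∨ᶜ β) ω
    ⋃⇒∨ {ω} (zero , lift p)          = lift (⊩-∨⁺ˡ {valuation ω} α β p)
    ⋃⇒∨ {ω} (suc zero , lift p)      = lift (⊩-∨⁺ʳ {valuation ω} α β p)
    ⋃⇒∨ {ω} (suc (suc _) , lift p)   = ⊥-elim (⊭ff {valuation ω} p)
    ∨⇒⋃ : ∀ {ω} → event (α ∨ᶜ β) ω → ⋃ ℕ events ω
    ∨⇒⋃ {ω} (lift p) with ⊩-∨⁻ {valuation ω} α β p
    ... | inj₁ q = 0 , lift q
    ... | inj₂ q = 1 , lift q
    disjoint : ∀ m n → m ≢ n → ∀ {ω} → ¬ (events m ω × events n ω)
    disjoint zero zero m≢n = ⊥-elim (m≢n ≡.refl)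
    disjoint zero (suc zero) _ {ω} (lift p , lift q) = exclusive⁻ α β excl (valuation ω) p q
    disjoint (suc zero) zero _ {ω} (lift p , lift q) = exclusive⁻ α β excl (valuation ω) q p
    disjoint (suc zero) (suc zero) m≢n = ⊥-elim (m≢n ≡.refl)
    disjoint (suc (suc _)) _ _ {ω} (lift p , _) = ⊭ff {valuation ω} p
    disjoint _ (suc (suc _)) _ {ω} (_ , lift q) = ⊭ff {valuation ω} q
    partial : ∀ n → partialSum (μ ∘ events) (2 ℕ.+ n) ≈ μ⟦ α ⟧ + μ⟦ β ⟧
    partial zero    = +-congʳ (+-identityˡ _)
    partial (suc n) = trans (+-cong (partial n) μ-ff) (+-identityʳ _)

  μ-⋁ : ∀ αs → AllPairs (λ α β → ⊨ᶜ ~ (α ∧ᶜ β)) αs → μ⟦ ⋁ᶜ αs ⟧ ≈ ∑ (map μ⟦_⟧ αs)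
  μ-⋁ []       []          = μ-ff
  μ-⋁ (α ∷ αs) (excl ∷ excls) = trans
    (μ-∨ α (⋁ᶜ αs) (exclusive α (⋁ᶜ αs) λ v v⊩α v⊩⋁ → none v v⊩α (find (⊩-⋁⁻ αs v⊩⋁))))
    (+-congˡ (μ-⋁ αs excls))
    where
    none : ∀ v → v ⊩ᶜ α → ¬ (∃ λ β → β ∈ αs × v ⊩ᶜ β)
    none v v⊩α (β , β∈αs , v⊩β) = exclusive⁻ α β (All.lookup excl β∈αs) v v⊩α v⊩β

  ∑-cong : ∀ {A : Set} {g h : A → Carrier} {xs} → All (λ x → g x ≈ h x) xs → ∑ (map g xs) ≈ ∑ (map h xs)
  ∑-cong []       = refl
  ∑-cong (p ∷ ps) = +-cong p (∑-cong ps)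

  ∑-μφ : ∀ {A Us} → Unique A → All (_∈ subsets A) Us → Unique Us →
    ∑ (map (μ⟦_⟧ ∘ φ[ A ,_]) Us) ≈ μ⟦ ⋁ᶜ (map φ[ A ,_] Us) ⟧
  ∑-μφ {A} {Us} uniqueA Us∈ uniqueU = begin-equality
    ∑ (map (μ⟦_⟧ ∘ φ[ A ,_]) Us)     ≡⟨ cong ∑ (map-∘ Us) ⟩
    ∑ (map μ⟦_⟧ (map φ[ A ,_] Us))   ≈⟨ μ-⋁ (map φ[ A ,_] Us) (φs-exclusive uniqueA Us∈ uniqueU) ⟨
    μ⟦ ⋁ᶜ (map φ[ A ,_] Us) ⟧        ∎

  Prob-≔ : ∀ {A U} → U ∈ subsets A → Prob[ A ≔ U ] ≈ μ⟦ φ[ A , U ] ⟧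
  Prob-≔ {A} {U} U∈ = μ-cong (𝓕-resp-≐ (⇐ , ⇒) (event-measurable φ[ A , U ])) (event-measurable φ[ A , U ]) (⇒ , ⇐)
    where
    ⇒ : ∀ {ω} → All (λ j → preimage j (⟨ U ⟩ j) ω) A → event φ[ A , U ] ω
    ⇒ {ω} agree = lift (⊩φ⁺ A U {valuation ω} (subset-⊆ A U∈) (All.map lower agree))
    ⇐ : ∀ {ω} → event φ[ A , U ] ω → All (λ j → preimage j (⟨ U ⟩ j) ω) A
    ⇐ {ω} (lift p) = All.map lift (⊩φ⁻ A U {valuation ω} p)

  -- The summands are the measures of the conjunctions over `⟦ α ⟧`. These exclude one another and
  -- their disjunction is equivalent to `α`, so additivity collapses the sum.
  Prob-μ : ∀ α → Prob α ≈ μ⟦ α ⟧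
  Prob-μ α = begin-equality
    ∑ (map Prob[ B[ α ] ≔_] (models α))             ≈⟨ ∑-cong (All.map Prob-≔ models⊆) ⟩
    ∑ (map (μ⟦_⟧ ∘ φ[ B[ α ] ,_]) (models α))       ≈⟨ ∑-μφ B-unique models⊆
                                                         (Unique.filter⁺ _∈⟦ α ⟧? (subsets-unique B-unique)) ⟩
    μ⟦ ⋁ᶜ (map φ[ B[ α ] ,_] (models α)) ⟧          ≈⟨ μ-⊩-cong (⋁ᶜ (map φ[ B[ α ] ,_] (models α))) α
                                                         (λ v → models⁻ {v} α) (λ v → models⁺ {v} α) ⟩
    μ⟦ α ⟧                                          ∎
    where
    B-unique : Unique B[ α ]
    B-unique = toSet-unique (occurrences α)
    models⊆ : All (_∈ subsets B[ α ]) (models α)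
    models⊆ = All.tabulate (proj₁ ∘ ∈-filter⁻ _∈⟦ α ⟧?)

  Prob-valid : ∀ α → ⊨ᶜ α → Prob α ≈ 1#
  Prob-valid α ⊨α = trans (Prob-μ α) (μ-valid α ⊨α)

  0≤Prob : ∀ α → 0# ≤ Prob α
  0≤Prob α = begin
    0#     ≤⟨ μ-nonNegative (event-measurable α) ⟩
    μ⟦ α ⟧ ≈⟨ Prob-μ α ⟨
    Prob α ∎

  Prob≤1 : ∀ α → Prob α ≤ 1#
  Prob≤1 α = begin
    Prob α              ≈⟨ Prob-μ α ⟩
    μ⟦ α ⟧              ≤⟨ x≤x+y (μ-nonNegative (event-measurable (~ α))) ⟩
    μ⟦ α ⟧ + μ⟦ ~ α ⟧   ≈⟨ μ-∨ α (~ α) (exclusive α (~ α) λ v v⊩α v⊩~α → ⊩-~⁻ {v} α v⊩~α v⊩α) ⟨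
    -- The disjunction `α ∨ᶜ ~ α` unfolds to `~ α ⊃ ~ α`, hence the identity as proof of validity.
    μ⟦ α ∨ᶜ ~ α ⟧       ≈⟨ μ-valid (α ∨ᶜ ~ α) (λ v → ⊩-⊃⁺ {v} (~ α) (~ α) λ p → p) ⟩
    1#                  ∎

  ∑-Probφ : ∀ {A} → Unique A → ∑ (map (Prob ∘ φ[ A ,_]) (subsets A)) ≈ 1#
  ∑-Probφ {A} uniqueA = begin-equality
    ∑ (map (Prob ∘ φ[ A ,_]) (subsets A))    ≈⟨ ∑-cong {xs = subsets A} (All.tabulate λ {U} _ → Prob-μ φ[ A , U ]) ⟩
    ∑ (map (μ⟦_⟧ ∘ φ[ A ,_]) (subsets A))    ≈⟨ ∑-μφ uniqueA (All.tabulate λ U∈ → U∈) (subsets-unique uniqueA) ⟩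
    μ⟦ ⋁ᶜ (map φ[ A ,_] (subsets A)) ⟧       ≈⟨ μ-valid (⋁ᶜ (map φ[ A ,_] (subsets A))) (⊨⋁φ A) ⟩
    1#                                       ∎

  Prob-dnf : ∀ {A α βs} → DNFConjuncts A α βs → Prob α ≈ ∑ (map Prob βs)
  Prob-dnf {A} {α} {βs} d = begin-equality
    Prob α            ≈⟨ Prob-μ α ⟩
    μ⟦ α ⟧            ≈⟨ μ-⊩-cong α (⋁ᶜ βs)
                           (λ v → ⊩-⊃⁻ {v} α (⋁ᶜ βs) (proj₁ (⊩-∧⁻ {v} (α ⊃ ⋁ᶜ βs) (⋁ᶜ βs ⊃ α) (dnf v))))
                           (λ v → ⊩-⊃⁻ {v} (⋁ᶜ βs) α (proj₂ (⊩-∧⁻ {v} (α ⊃ ⋁ᶜ βs) (⋁ᶜ βs ⊃ α) (dnf v)))) ⟩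
    μ⟦ ⋁ᶜ βs ⟧        ≈⟨ μ-⋁ βs excl ⟩
    ∑ (map μ⟦_⟧ βs)   ≈⟨ ∑-cong {xs = βs} (All.tabulate λ {β} _ → Prob-μ β) ⟨
    ∑ (map Prob βs)   ∎
    where open DNFConjuncts d using (dnf) renaming (exclusive to excl)

-- First-order formulas over an ordered field

module _ (K : OrderedField) where

  evalᵗ-cong : ∀ t {ρ ρ′ : Assignment K} → (∀ x → ρ x ≡ ρ′ x) → evalᵗ K ρ t ≡ evalᵗ K ρ′ t
  evalᵗ-cong (var x) ρ≡ρ′ = ρ≡ρ′ x
  evalᵗ-cong 𝟘       ρ≡ρ′ = ≡.refl
  evalᵗ-cong 𝟙       ρ≡ρ′ = ≡.refl
  evalᵗ-cong (⊖ t)   ρ≡ρ′ = cong (OrderedField.-_ K) (evalᵗ-cong t ρ≡ρ′)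
  evalᵗ-cong (t ⊕ u) ρ≡ρ′ = cong₂ (OrderedField._+_ K) (evalᵗ-cong t ρ≡ρ′) (evalᵗ-cong u ρ≡ρ′)
  evalᵗ-cong (t ⊗ u) ρ≡ρ′ = cong₂ (OrderedField._*_ K) (evalᵗ-cong t ρ≡ρ′) (evalᵗ-cong u ρ≡ρ′)

  update-cong : ∀ {ρ ρ′ : Assignment K} y a → (∀ x → ρ x ≡ ρ′ x) →
    ∀ x → _[_↦_] K ρ y a x ≡ _[_↦_] K ρ′ y a x
  update-cong y a ρ≡ρ′ x with x ≟ˣ y
  ... | yes _ = ≡.refl
  ... | no  _ = ρ≡ρ′ x

  update-same : ∀ (ρ : Assignment K) y x → _[_↦_] K ρ y (ρ y) x ≡ ρ x
  update-same ρ y x with x ≟ˣ y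
  ... | yes ≡.refl = ≡.refl
  ... | no  _      = ≡.refl

  -- Updating a variable with its own value restores an assignment only pointwise, so truth has to
  -- be invariant under pointwise equality. The premise of an implication is transported backwards.
  Holds-cong : ∀ φ {ρ ρ′ : Assignment K} → (∀ x → ρ x ≡ ρ′ x) → Holds K ρ φ → Holds K ρ′ φ
  Holds-cong (t ≐ᶠ u) ρ≡ρ′ = subst₂ (OrderedField._≈_ K) (evalᵗ-cong t ρ≡ρ′) (evalᵗ-cong u ρ≡ρ′)
  Holds-cong (t ≺ᶠ u) ρ≡ρ′ = subst₂ (OrderedField._<_ K) (evalᵗ-cong t ρ≡ρ′) (evalᵗ-cong u ρ≡ρ′)
  Holds-cong ⊥ᶠ       ρ≡ρ′ = λ ()
  Holds-cong (φ ⇒ᶠ ψ) ρ≡ρ′ φ⇒ψ p = Holds-cong ψ ρ≡ρ′ (φ⇒ψ (Holds-cong φ (≡.sym ∘ ρ≡ρ′) p))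
  Holds-cong (∀ᶠ x φ) ρ≡ρ′ ∀φ a = Holds-cong φ (update-cong x a ρ≡ρ′) (∀φ a)

  -- Instantiating every quantified variable with its own value leaves ρ unchanged.
  Holds-∀⁻ : ∀ xs φ (ρ : Assignment K) → Holds K ρ (foldr ∀ᶠ φ xs) → Holds K ρ φ
  Holds-∀⁻ []       φ ρ p = p
  Holds-∀⁻ (x ∷ xs) φ ρ p =
    Holds-∀⁻ xs φ ρ (Holds-cong (foldr ∀ᶠ φ xs) (update-same ρ x) (p (ρ x)))

  Holds-⋀⁺ : ∀ {ρ φs} → All (Holds K ρ) φs → Holds K ρ (⋀ᶠ φs)
  Holds-⋀⁺ []       = λ p → p
  Holds-⋀⁺ (p ∷ ps) = λ ¬both → ¬both p (Holds-⋀⁺ ps)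

  Holds-≼⁺ : ∀ {ρ} t u → OrderedField._≤_ K (evalᵗ K ρ t) (evalᵗ K ρ u) → Holds K ρ (t ≼ᶠ u)
  Holds-≼⁺ _ _ (inj₁ t<u) _   = t<u
  Holds-≼⁺ _ _ (inj₂ t≈u) t≉u = ⊥-elim (t≉u t≈u)

-- Soundness

module Soundness (ℝ : Reals) {ℓ f} (𝓥 : StochasticValuation ℝ ℓ f)
                 (ρ : Assignment (Reals.orderedField ℝ)) where
  open Reals ℝ
  open StochasticValuation 𝓥 using (Prob)
  open OrderedFieldProperties orderedField using (≮⇒≥)
  open RealsProperties ℝ using (realClosedField)
  open EventProbability ℝ 𝓥 using (Prob-valid; 0≤Prob; Prob≤1; ∑-Probφ; Prob-dnf)
  open IsStrictTotalOrder isStrictTotalOrder using (irrefl; asym; _≟_; _<?_)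

  Sat : PPL → Set
  Sat = Satisfies ℝ 𝓥 ρ

  sat? : ∀ φ → Dec (Sat φ)
  sat? (∫ α [ eq ] p) = _ ≟ _
  sat? (∫ α [ lt ] p) = _ <? _
  sat? (φ ⊃ᵖ ψ)       = ¬? (sat? φ) ⊎-dec sat? ψ

  -- This formula plays the part of falsum in `¬ᵖ_`; it fails everywhere because `tt` has
  -- probability 1.
  ¬Sat-⊥ : ¬ Sat (∫ tt [ lt ] 𝟙)
  ¬Sat-⊥ = irrefl (Prob-valid tt ⊨tt)

  Sat-¬⁻ : ∀ φ → Sat (¬ᵖ φ) → ¬ Sat φ
  Sat-¬⁻ φ (inj₁ ¬φ) = ¬φ
  Sat-¬⁻ φ (inj₂ bad) = ⊥-elim (¬Sat-⊥ bad)

  -- The encoded conjunction only refutes the failure of a conjunct, so the conjuncts themselves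
  -- come from deciding them.
  Sat-∧⁻ : ∀ φ ψ → Sat (φ ∧ᵖ ψ) → Sat φ × Sat ψ
  Sat-∧⁻ φ ψ φ∧ψ with sat? φ | sat? ψ
  ... | yes p | yes q = p , q
  ... | no ¬p | _     = ⊥-elim (Sat-¬⁻ (φ ⊃ᵖ ¬ᵖ ψ) φ∧ψ (inj₁ ¬p))
  ... | _     | no ¬q = ⊥-elim (Sat-¬⁻ (φ ⊃ᵖ ¬ᵖ ψ) φ∧ψ (inj₂ (inj₁ ¬q)))

  module _ (σ : ℕ → PPL) where

    truth : Valuation
    truth j = does (sat? (σ j))

    -- The two directions are mutually recursive, since a negation and the left side of an
    -- implication exchange them.
    instantiate⁺ : ∀ τ → truth ⊩ᶜ τ → Sat (instantiate σ τ)
    instantiate⁻ : ∀ τ → Sat (instantiate σ τ) → truth ⊩ᶜ τ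

    instantiate⁺ (B j) v⊩ with sat? (σ j)
    ... | yes p = p
    instantiate⁺ (~ α)   v⊩ = inj₁ (⊩-~⁻ {truth} α v⊩ ∘ instantiate⁻ α)
    instantiate⁺ (α ⊃ β) v⊩ with sat? (instantiate σ α)
    ... | no ¬p = inj₁ ¬p
    ... | yes p = inj₂ (instantiate⁺ β (⊩-⊃⁻ {truth} α β v⊩ (instantiate⁻ α p)))

    instantiate⁻ (B j)   p        = dec-true (sat? (σ j)) p
    instantiate⁻ (~ α)   p        = ⊩-~⁺ {truth} α (Sat-¬⁻ (instantiate σ α) p ∘ instantiate⁺ α)
    instantiate⁻ (α ⊃ β) (inj₁ ¬p) = ⊩-⊃⁺ {truth} α β (⊥-elim ∘ ¬p ∘ instantiate⁺ α)
    instantiate⁻ (α ⊃ β) (inj₂ q) = ⊩-⊃⁺ {truth} α β λ _ → instantiate⁻ β q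

  -- From constraints on probabilities to constraints on real variables, and back

  ρᴾ : Assignment orderedField
  ρᴾ (xᴺ k) = ρ (xᴺ k)
  ρᴾ (xᴸ α) = Prob α

  -- Here the restriction on bounds is used: they contain no variable `xᴸ α`, so overwriting those
  -- variables by probabilities does not move them.
  evalᵗ-⌜⌝ : ∀ p → evalᵗ orderedField ρᴾ ⌜ p ⌝ ≡ evalᵗ orderedField ρ ⌜ p ⌝
  evalᵗ-⌜⌝ (var k) = ≡.refl
  evalᵗ-⌜⌝ 𝟘       = ≡.refl
  evalᵗ-⌜⌝ 𝟙       = ≡.refl
  evalᵗ-⌜⌝ (⊖ t)   = cong -_ (evalᵗ-⌜⌝ t)
  evalᵗ-⌜⌝ (t ⊕ u) = cong₂ _+_ (evalᵗ-⌜⌝ t) (evalᵗ-⌜⌝ u)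
  evalᵗ-⌜⌝ (t ⊗ u) = cong₂ _*_ (evalᵗ-⌜⌝ t) (evalᵗ-⌜⌝ u)

  constraint⁺ : ∀ c → Sat (∫ᶜ c) → Holds orderedField ρᴾ (xᶜ c)
  constraint⁺ (α [ eq ] p) h rewrite evalᵗ-⌜⌝ p = h
  constraint⁺ (α [ lt ] p) h rewrite evalᵗ-⌜⌝ p = h
  constraint⁺ (α [ le ] p) (inj₁ ¬≉) ≉ rewrite evalᵗ-⌜⌝ p = ⊥-elim (¬≉ (inj₁ ≉))
  constraint⁺ (α [ le ] p) (inj₂ <p) ≉ rewrite evalᵗ-⌜⌝ p = <p
  constraint⁺ (α [ ge ] p) h =
    Holds-≼⁺ orderedField {ρᴾ} ⌜ p ⌝ (var (xᴸ α)) (subst (_≤ _) (≡.sym (evalᵗ-⌜⌝ p)) (≮⇒≥ (Sat-¬⁻ (∫ α [ lt ] p) h)))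

  -- For `le`, `Holds` offers only an implication from the failure of the equation, whereas `Sat`
  -- asks for one side of a sum; deciding the equation bridges the gap.
  constraint⁻ : ∀ c → Holds orderedField ρᴾ (xᶜ c) → Sat (∫ᶜ c)
  constraint⁻ (α [ eq ] p) h rewrite evalᵗ-⌜⌝ p = h
  constraint⁻ (α [ lt ] p) h rewrite evalᵗ-⌜⌝ p = h
  constraint⁻ (α [ le ] p) h rewrite evalᵗ-⌜⌝ p with sat? (∫ α [ eq ] p)
  ... | yes ≈p = inj₁ λ ¬≈p → Sat-¬⁻ (∫ α [ eq ] p) ¬≈p ≈p
  ... | no ≉p  = inj₂ (h ≉p)
  constraint⁻ (α [ ge ] p) h rewrite evalᵗ-⌜⌝ p =
    inj₁ λ <p → asym <p (h λ p≈ → irrefl (sym p≈) <p)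

  premises⁺ : ∀ d ds → Sat (foldr₁ _∧ᵖ_ (∫ᶜ d ∷⁺ map ∫ᶜ ds)) →
    All (Holds orderedField ρᴾ) (map xᶜ (d ∷ ds))
  premises⁺ d []       h = constraint⁺ d h ∷ []
  premises⁺ d (c ∷ cs) h = constraint⁺ d (proj₁ split) ∷ premises⁺ c cs (proj₂ split)
    where split = Sat-∧⁻ (∫ᶜ d) (foldr₁ _∧ᵖ_ (∫ᶜ c ∷⁺ map ∫ᶜ cs)) h

  -- The map `g` covers both kinds of sums in Q: over subsets, by way of `φ[ A ,_]`, and over given
  -- conjuncts, by way of the identity.
  evalᵗ-∑ : ∀ {A : Set} (g : A → L) xs →
    evalᵗ orderedField ρᴾ (∑ᵗ (map (var ∘ xᴸ ∘ g) xs)) ≡ ∑ (map (Prob ∘ g) xs)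
  evalᵗ-∑ g []       = ≡.refl
  evalᵗ-∑ g (x ∷ xs) = cong (Prob (g x) +_) (evalᵗ-∑ g xs)

  -- The bounds hold for the probability of any formula, and the sum is 1 because exactly one of the
  -- conjunctions over `subsets A` is true at each outcome. Adequacy enters through the equations
  -- for the individual formulas.
  Q-holds : ∀ αs Λ → Adequate αs Λ → Holds orderedField ρᴾ (Q αs Λ)
  Q-holds αs Λ adequate ¬Q = ¬Q
    (Holds-⋀⁺ orderedField bounds)
    (λ ¬rest → ¬rest
      (subst (_≈ 1#) (≡.sym (evalᵗ-∑ φ[ A ,_] (subsets A))) (∑-Probφ (toSet-unique (concatMap occurrences αs))))
      (Holds-⋀⁺ orderedField (dnfs adequate)))
    where
    A = B⋃ αs
    in-[0,1] : ∀ α → Holds orderedField ρᴾ (𝟘 ≼ᶠ var (xᴸ α) ∧ᶠ var (xᴸ α) ≼ᶠ 𝟙)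
    in-[0,1] α ¬both = ¬both (Holds-≼⁺ orderedField {ρᴾ} 𝟘 (var (xᴸ α)) (0≤Prob α))
                             (Holds-≼⁺ orderedField {ρᴾ} (var (xᴸ α)) 𝟙 (Prob≤1 α))
    bounds : All (Holds orderedField ρᴾ)
      (map (λ x → 𝟘 ≼ᶠ x ∧ᶠ x ≼ᶠ 𝟙) (map (λ U → var (xᴸ φ[ A , U ])) (subsets A)))
    bounds = All.map⁺ (All.map⁺ (All.tabulate λ {U} _ → in-[0,1] φ[ A , U ]))
    dnfs : ∀ {αs Λ} → Pointwise (DNFConjuncts A) αs Λ →
      All (Holds orderedField ρᴾ) (zipWith (λ α βs → var (xᴸ α) ≐ᶠ ∑ᵗ (map (var ∘ xᴸ) βs)) αs Λ)
    dnfs [] = []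
    dnfs (_∷_ {y = βs} d ds) = subst (_ ≈_) (≡.sym (evalᵗ-∑ (λ β → β) βs)) (Prob-dnf d) ∷ dnfs ds

  -- Kept apart from `axiom-sound` because `_⟶_` drops the implication when there are no premises;
  -- both shapes of the axiom reduce to this one semantic step.
  RR-conclusion : ∀ cs c Λ → Adequate (map formula (cs ∷ʳ c)) Λ →
    RCOF-Theorem (universalClosure (Q (map formula (cs ∷ʳ c)) Λ ∧ᶠ ⋀ᶠ (map xᶜ cs) ⇒ᶠ xᶜ c)) →
    All (Holds orderedField ρᴾ) (map xᶜ cs) → Sat (∫ᶜ c)
  RR-conclusion cs c Λ adequate thm premises =
    constraint⁻ c (Holds-∀⁻ orderedField (freeVars matrix) matrix ρᴾ (thm realClosedField ρᴾ)
      λ ¬both → ¬both (Q-holds _ Λ adequate) (Holds-⋀⁺ orderedField premises))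
    where matrix = Q (map formula (cs ∷ʳ c)) Λ ∧ᶠ ⋀ᶠ (map xᶜ cs) ⇒ᶠ xᶜ c

  axiom-sound : ∀ {φ} → Axiom φ → Sat φ
  axiom-sound (TT τ σ ⊨τ) = instantiate⁺ σ τ (⊨τ (truth σ))
  axiom-sound (RR [] c Λ adequate thm) = RR-conclusion [] c Λ adequate thm []
  axiom-sound (RR (d ∷ ds) c Λ adequate thm) with sat? (foldr₁ _∧ᵖ_ (∫ᶜ d ∷⁺ map ∫ᶜ ds))
  ... | no ¬p = inj₁ ¬p
  ... | yes p = inj₂ (RR-conclusion (d ∷ ds) c Λ adequate thm (premises⁺ d ds p))

  ⊢-sound : ∀ {g} {Γ : Pred PPL g} {φ} → (∀ γ → Γ γ → Sat γ) → Γ ⊢ φ → Sat φ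
  ⊢-sound satΓ (hyp γ∈Γ) = satΓ _ γ∈Γ
  ⊢-sound satΓ (axiom a) = axiom-sound a
  ⊢-sound satΓ (MP ⊢φ ⊢φ⊃ψ) with ⊢-sound satΓ ⊢φ⊃ψ
  ... | inj₁ ¬φ = ⊥-elim (¬φ (⊢-sound satΓ ⊢φ))
  ... | inj₂ ψ  = ψ

theorem5p1 : (ℝ : Reals) (ℓ f : Level) {g : Level} (Γ : Pred PPL g) (φ : PPL) →
    Γ ⊢ φ → Γ ⊨[ ℝ , ℓ , f ] φ
theorem5p1 ℝ ℓ f Γ φ ⊢φ 𝓥 ρ satΓ = Soundness.⊢-sound ℝ 𝓥 ρ satΓ ⊢φ
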